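{- Suppose that there is a computable function $f$ such that the feasibility problem for uniform $4$-block programs $P$ can be solved in time $f(k,\Delta)\cdot\|P\|^{O(1)}$, where $k$ is the dimension of every block and $\Delta$ is the maximum absolute value of any entry in the constraint matrix. Then there is a computable function $g$ such that the feasibility problem for uniform $4$-block programs $P$, under the assumption that all the absolute values of the entries in the matrices $A,B,C$ are bounded by $n$, can be solved in time $g(k,\max_i\|D_i\|_\infty)\cdot\|P\|^{O(1)}$.
   Context: A uniform $4$-block program $P$ with $n$ diagonal blocks and block dimension $k$ consists of integer $k\times k$ matrices $A,B,C,D_1,\dots,D_n$ and integer vectors $\mathbf a,\mathbf b_1,\dots,\mathbf b_n\in\mathbb Z^k$. Its feasibility problem asks whether there exist $\mathbf x,\mathbf y_1,\dots,\mathbf y_n\in\mathbb Z_{\ge 0}^k$ such that $$B\mathbf x+\sum_{t=1}^n C\mathbf y_t=\mathbf a\qquad\text{and}\qquad A\mathbf x+D_t\mathbf y_t=\mathbf b_t\quad\text{for all } t=1,\dots,n.$$ The matrices $D_t$ may differ for different $t$. The constraint matrix is the matrix composed of all blocks $A,B,C,D_1,\dots,D_n$ (with zeros elsewhere). $\|D\|_\infty$ denotes the maximum absolute value of an entry of a matrix $D$, and $\|P\|$ denotes the total bitsize of the encoding of $P$, with all numbers encoded in binary. -}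

module Defs where

open import Data.Bool.Base using (Bool; true; false)
open import Data.Fin.Base using (Fin; zero; suc)
open import Data.Fin.Properties using (_≟_)
open import Data.Integer.Base as ℤ using (ℤ; +_; -[1+_]; ∣_∣; 0ℤ)
import Data.Integer.Properties as ℤ
open import Data.Nat.Base using (ℕ; zero; suc; _+_; _*_; _^_; _≤_; _⊔_)
open import Data.Nat.Binary.Base as ℕᵇ using (ℕᵇ; 2[1+_]; 1+[2_])
open import Data.Product.Base using (Σ-syntax; ∃-syntax; _×_; _,_)
open import Data.Vec.Base as Vec using (Vec; _∷_; lookup; _[_]≔_)
open import Data.Vec.Functional using (Vector; foldr)
open import Function.Bundles using (_⇔_)
open import Relation.Binary.PropositionalEquality using (_≡_; _≢_)
open import Relation.Nullary.Decidable using (yes; no)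

open import Algebra.Properties.Semiring.Sum ℤ.+-*-semiring using (sum-syntax)

------------------------------------------------------------------------
-- Uniform 4-block programs

Matrix : ℕ → Set
Matrix k = Vector (Vector ℤ k) k

_·_ : ∀ {k} → Matrix k → Vector ℕ k → Vector ℤ k
_·_ {k} M v i = ∑[ j < k ] (M i j ℤ.* + v j)

record FourBlock (n k : ℕ) : Set where
  field
    A B C : Matrix k
    D     : Vector (Matrix k) n
    a     : Vector ℤ k
    b     : Vector (Vector ℤ k) n

open FourBlock public

Feasible : ∀ {n k} → FourBlock n k → Set
Feasible {n} {k} P =
  Σ[ x ∈ Vector ℕ k ] Σ[ y ∈ Vector (Vector ℕ k) n ]
    (∀ i → (B P · x) i ℤ.+ ∑[ t < n ] ((C P · y t) i) ≡ a P i)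
  × (∀ t i → (A P · x) i ℤ.+ (D P t · y t) i ≡ b P t i)

-- The maximum of the empty family is 0.
maximum : ∀ {m} → Vector ℕ m → ℕ
maximum = foldr _⊔_ 0

‖_‖∞ : ∀ {k} → Matrix k → ℕ
‖ M ‖∞ = maximum λ i → maximum λ j → ∣ M i j ∣

-- The constraint matrix as an (n+1)×(n+1) array of k×k blocks: block row
-- (column) zero is the one of the equations (variables) shared by all t.
constraintMatrix : ∀ {n k} → FourBlock n k → Vector (Vector (Matrix k) (suc n)) (suc n)
constraintMatrix P zero    zero    = B P
constraintMatrix P zero    (suc t) = C P
constraintMatrix P (suc s) zero    = A P
constraintMatrix P (suc s) (suc t) with s ≟ t
... | yes _ = D P s
... | no  _ = λ _ _ → 0ℤ

Δ : ∀ {n k} → FourBlock n k → ℕ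
Δ P = maximum λ s → maximum λ t → ‖ constraintMatrix P s t ‖∞

max‖D‖ : ∀ {n k} → FourBlock n k → ℕ
max‖D‖ P = maximum λ t → ‖ D P t ‖∞

ABCBoundedBy-n : ∀ {n k} → FourBlock n k → Set
ABCBoundedBy-n {n} P =
  ∀ i j → ∣ A P i j ∣ ≤ n × ∣ B P i j ∣ ≤ n × ∣ C P i j ∣ ≤ n

------------------------------------------------------------------------
-- Model of computation: the WHILE language on binary trees of N. D. Jones,
-- "Computability and Complexity from a Programming Perspective" (1997),
-- with a conditional added.  Trees only have a nil test and every operation
-- costs one unit.  With trees represented as pointers (so that copying is
-- a pointer copy), each unit is a constant number of pointer operations, so
-- running times agree with those of Turing machines up to a polynomial.

data Tree : Set where
  nil  : Tree
  cons : Tree → Tree → Tree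

hd tl : Tree → Tree
hd nil        = nil
hd (cons l r) = l
tl nil        = nil
tl (cons l r) = r

Store : ℕ → Set
Store m = Vec Tree m

data Expr (m : ℕ) : Set where
  var   : Fin m → Expr m
  nilE  : Expr m
  consE : Expr m → Expr m → Expr m
  hdE   : Expr m → Expr m
  tlE   : Expr m → Expr m

eval : ∀ {m} → Expr m → Store m → Tree
eval (var x)     σ = lookup σ x
eval nilE        σ = nil
eval (consE e f) σ = cons (eval e σ) (eval f σ)
eval (hdE e)     σ = hd (eval e σ)
eval (tlE e)     σ = tl (eval e σ)

cost : ∀ {m} → Expr m → ℕ
cost (var x)     = 1
cost nilE        = 1
cost (consE e f) = suc (cost e + cost f)
cost (hdE e)     = suc (cost e)
cost (tlE e)     = suc (cost e)

infixr 5 _⨾_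
infix  6 _:=_

data Cmd (m : ℕ) : Set where
  _:=_          : Fin m → Expr m → Cmd m
  _⨾_           : Cmd m → Cmd m → Cmd m
  if_then_else_ : Expr m → Cmd m → Cmd m → Cmd m
  while_loop_   : Expr m → Cmd m → Cmd m

infix 4 ⟨_,_⟩⇓[_]_

-- ⟨ c , σ ⟩⇓[ t ] σ′ : started in store σ, the command c halts after exactly
-- t time units in store σ′.
data ⟨_,_⟩⇓[_]_ {m : ℕ} : Cmd m → Store m → ℕ → Store m → Set where
  assign : ∀ {x e σ} →
    ⟨ x := e , σ ⟩⇓[ suc (cost e) ] (σ [ x ]≔ eval e σ)
  seq : ∀ {c d σ σ′ σ″ s t} →
    ⟨ c , σ ⟩⇓[ s ] σ′ → ⟨ d , σ′ ⟩⇓[ t ] σ″ →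
    ⟨ c ⨾ d , σ ⟩⇓[ suc (s + t) ] σ″
  if-true : ∀ {e c d σ σ′ t} → eval e σ ≢ nil →
    ⟨ c , σ ⟩⇓[ t ] σ′ →
    ⟨ if e then c else d , σ ⟩⇓[ suc (cost e + t) ] σ′
  if-false : ∀ {e c d σ σ′ t} → eval e σ ≡ nil →
    ⟨ d , σ ⟩⇓[ t ] σ′ →
    ⟨ if e then c else d , σ ⟩⇓[ suc (cost e + t) ] σ′
  while-false : ∀ {e c σ} → eval e σ ≡ nil →
    ⟨ while e loop c , σ ⟩⇓[ suc (cost e) ] σ
  while-true : ∀ {e c σ σ′ σ″ s t} → eval e σ ≢ nil →
    ⟨ c , σ ⟩⇓[ s ] σ′ → ⟨ while e loop c , σ′ ⟩⇓[ t ] σ″ →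
    ⟨ while e loop c , σ ⟩⇓[ suc (cost e + (s + t)) ] σ″

-- A program has at least one variable; the first one carries the input and
-- the output, and all the others are nil initially.
record Program : Set where
  constructor program
  field
    {others} : ℕ
    body     : Cmd (suc others)

open Program public

_on_outputs_inTime_ : Program → Tree → Tree → ℕ → Set
p on input outputs output inTime t =
  Σ[ σ ∈ Store (others p) ]
    ⟨ body p , input ∷ Vec.replicate (others p) nil ⟩⇓[ t ] (output ∷ σ)

------------------------------------------------------------------------
-- Encodings

encodeVector : ∀ {X : Set} {m} → (X → Tree) → Vector X m → Tree
encodeVector enc = foldr (λ x → cons (enc x)) nil

encodeBool : Bool → Tree
encodeBool false = nil
encodeBool true  = cons nil nil

-- Least significant digit first.  The digits of ℕᵇ are 1 and 2 instead of 0
-- and 1; the number of digits differs from that of ordinary binary by at most 1.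
encodeℕᵇ : ℕᵇ → Tree
encodeℕᵇ ℕᵇ.zero  = nil
encodeℕᵇ 2[1+ u ] = cons (encodeBool true) (encodeℕᵇ u)
encodeℕᵇ 1+[2 u ] = cons (encodeBool false) (encodeℕᵇ u)

encodeℤ : ℤ → Tree
encodeℤ (+ m)    = cons (encodeBool false) (encodeℕᵇ (ℕᵇ.fromℕ m))
encodeℤ -[1+ m ] = cons (encodeBool true) (encodeℕᵇ (ℕᵇ.fromℕ (suc m)))

encodeMatrix : ∀ {k} → Matrix k → Tree
encodeMatrix = encodeVector (encodeVector encodeℤ)

-- n and k are present as the lengths of the last two components.
encode : ∀ {n k} → FourBlock n k → Tree
encode P =
  cons (encodeMatrix (A P)) (cons (encodeMatrix (B P)) (cons (encodeMatrix (C P))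
    (cons (encodeVector encodeℤ (a P))
          (encodeVector (λ t → cons (encodeMatrix (D P t)) (encodeVector encodeℤ (b P t)))
                        (λ t → t)))))

-- The number of nodes, that is, the length of the bit string obtained by
-- writing the tree in preorder with 1 for cons and 0 for nil.
size : Tree → ℕ
size nil        = 1
size (cons l r) = suc (size l + size r)

‖_‖ : ∀ {n k} → FourBlock n k → ℕ
‖ P ‖ = size (encode P)

encodeUnary : ℕ → Tree
encodeUnary zero    = nil
encodeUnary (suc m) = cons nil (encodeUnary m)

------------------------------------------------------------------------
-- Computability and parameterized running time

-- No time bound is imposed here, so the choice of numerals is immaterial.
Computable₂ : (ℕ → ℕ → ℕ) → Set
Computable₂ f = Σ[ p ∈ Program ] (∀ i j → ∃[ t ]
  p on cons (encodeUnary i) (encodeUnary j) outputs encodeUnary (f i j) inTime t)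

-- Feasibility of the programs P satisfying the promise is decided in time
-- bound P · ‖P‖^O(1).
FeasibilitySolvable : (promise : ∀ {n k} → FourBlock n k → Set)
                      (bound : ∀ {n k} → FourBlock n k → ℕ) → Set
FeasibilitySolvable promise bound =
  Σ[ p ∈ Program ] ∃[ c ] (∀ {n k} (P : FourBlock n k) → promise P →
    Σ[ answer ∈ Bool ] ∃[ t ]
      p on encode P outputs encodeBool answer inTime t
    × t ≤ bound P * ‖ P ‖ ^ c
    × (answer ≡ true ⇔ Feasible P))

{-# OPTIONS --safe #-}
module Submission where

-- Since an entry m of A, B or C satisfies ∣ m ∣ ≤ n, it is a sum of one sign
-- mₜ ∈ {-1, 0, 1} per block, and the coefficients of a local copy of x may vary
-- with t because they belong to Dₜ.  So the contribution of the t-th sign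
-- matrix to B x is computed inside block t, and the shared equations add up the
-- contributions.  C is treated like B, with s = ∑ yₜ as an additional shared
-- variable, and A x is made available to all blocks as a difference u⁺ - u⁻ of
-- shared variables.  Local variables are nonnegative, so block t computes
-- (Mₜ + J) x instead of Mₜ x, where J is the all-ones matrix, and the shared
-- equations subtract J x again.  The dimension grows to 5 k, and the entries are
-- bounded by 2 and those of D.
--
-- The reduction runs in polynomial time in the WHILE language: the programs
-- whose time and output size are polynomially bounded are closed under
-- composition, pairing, branching, and folds whose accumulator grows additively.

open import Data.Bool.Base using (Bool; true; false) renaming (if_then_else_ to ifᵇ_then_else_)
open import Data.Empty using (⊥)
open import Data.Fin.Base using (Fin; zero; suc; toℕ; combine; remQuot; _↑ˡ_; _↑ʳ_)
open import Data.Fin.Patterns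
import Data.Fin.Properties as Fin
open import Data.Integer.Base as ℤ using (ℤ; +_; -[1+_]; ∣_∣; 0ℤ; 1ℤ; -1ℤ)
  renaming (_+_ to infixl 6 _+ℤ_; -_ to -ℤ_)
import Data.Integer.Properties as ℤ
import Data.Integer.Tactic.RingSolver as ℤ-Solver
open import Data.Nat.Base
open import Data.Nat.Binary.Base as ℕᵇ using (ℕᵇ; 2[1+_]; 1+[2_])
import Data.Nat.Binary.Properties as ℕᵇ
open import Data.Nat.Properties
open import Data.Nat.Tactic.RingSolver using (solve-∀)
open import Data.Product.Base using (Σ-syntax; ∃-syntax; _×_; _,_; proj₁; proj₂; uncurry)
open import Data.Unit.Base using (⊤; tt)
open import Data.Vec.Base as Vec using (Vec; []; _∷_; lookup)
open import Data.Vec.Functional using (Vector)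
open import Data.Vec.Properties using (lookup-map)
open import Function.Base using (_∘_)
open import Function.Bundles using (_⇔_; mk⇔)
open import Function.Properties.Equivalence using () renaming (trans to ⇔-trans)
open import Relation.Binary.PropositionalEquality hiding (J)
open import Relation.Nullary using (contradiction; yes; no; does)
open import Algebra.Properties.Semiring.Sum ℤ.+-*-semiring
  using (sum; sum-syntax; sum-cong-≗; sum-replicate-zero;
    ∑-distrib-+; ∑-comm; *-distribˡ-sum; *-distribʳ-sum)
import Algebra.Properties.Semiring.Sum +-*-semiring as ℕ-Sum
open import Defs

-- Polynomial bounds

-- The base is at least 2, so a single exponent describes the bound: constants, sums and products
-- are absorbed by a larger power, without a leading coefficient.
PolyBounded : (Tree → ℕ) → Set
PolyBounded h = ∃[ e ] (∀ v → h v ≤ (2 + size v) ^ e)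

n≤[2+m]^n : ∀ m n → n ≤ (2 + m) ^ n
n≤[2+m]^n m zero    = z≤n
n≤[2+m]^n m (suc n) = begin
  1 + n                    ≤⟨ +-mono-≤ (m^n>0 (2 + m) n) (n≤[2+m]^n m n) ⟩
  N + N                    ≤⟨ +-monoʳ-≤ N (m≤m+n N (m * N)) ⟩
  (2 + m) * N              ∎
  where
  open ≤-Reasoning
  N = (2 + m) ^ n

poly-≤ : ∀ {h h′} → (∀ v → h v ≤ h′ v) → PolyBounded h′ → PolyBounded h
poly-≤ h≤h′ (e , h′≤) = e , λ v → ≤-trans (h≤h′ v) (h′≤ v)

poly-const : ∀ c → PolyBounded (λ _ → c)
poly-const c = c , λ v → n≤[2+m]^n (size v) c

poly-size : PolyBounded size
poly-size = 1 , λ v → ≤-trans (m≤n+m (size v) 2) (≤-reflexive (sym (*-identityʳ _)))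

poly-* : ∀ {h h′} → PolyBounded h → PolyBounded h′ → PolyBounded (λ v → h v * h′ v)
poly-* (d , h≤) (e , h′≤) = d + e , λ v →
  ≤-trans (*-mono-≤ (h≤ v) (h′≤ v)) (≤-reflexive (sym (^-distribˡ-+-* (2 + size v) d e)))

poly-+ : ∀ {h h′} → PolyBounded h → PolyBounded h′ → PolyBounded (λ v → h v + h′ v)
poly-+ {h} {h′} (d , h≤) (e , h′≤) = suc (d + e) , λ v → begin
  h v + h′ v                                    ≤⟨ +-mono-≤ (h≤ v) (h′≤ v) ⟩
  (2 + size v) ^ d + (2 + size v) ^ e           ≤⟨ +-mono-≤ (^-monoʳ-≤ (2 + size v) (m≤m+n d e))
                                                            (^-monoʳ-≤ (2 + size v) (m≤n+m e d)) ⟩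
  (2 + size v) ^ (d + e) + (2 + size v) ^ (d + e) ≤⟨ +-monoʳ-≤ ((2 + size v) ^ (d + e)) (m≤m+n _ _) ⟩
  (2 + size v) ^ suc (d + e)                    ∎
  where open ≤-Reasoning

poly-^ : ∀ {h} → PolyBounded h → ∀ n → PolyBounded (λ v → h v ^ n)
poly-^ p zero    = poly-const 1
poly-^ p (suc n) = poly-* p (poly-^ p n)

poly-∘ : ∀ {h} {F : Tree → Tree} → PolyBounded h → PolyBounded (size ∘ F) → PolyBounded (h ∘ F)
poly-∘ {F = F} (e , h≤) p = poly-≤ (λ v → h≤ (F v)) (poly-^ (poly-+ (poly-const 2) p) e)

-- Polynomial-time functions

-- The first variable holds a stack whose top is replaced by its image.
record PolyTime : Set where
  field
    ⟦_⟧       : Tree → Tree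
    -- Quantifying over the number of other variables lets the code be placed in front of a program
    -- with any number of them.
    code      : ∀ {m} → Cmd (suc m)
    time      : Tree → ℕ
    time-poly : PolyBounded time
    size-poly : PolyBounded (size ∘ ⟦_⟧)
    runs      : ∀ {m} v r (ρ : Store m) →
                ∃[ t ] ⟨ code , cons v r ∷ ρ ⟩⇓[ t ] (cons (⟦_⟧ v) r ∷ ρ) × t ≤ time v

open PolyTime public

stack : ∀ {m} → Expr (suc m)
stack = var zero

size-hd : ∀ v → size (hd v) ≤ size v
size-hd nil        = ≤-refl
size-hd (cons l r) = m≤n⇒m≤1+n (m≤m+n (size l) (size r))

size-tl : ∀ v → size (tl v) ≤ size v
size-tl nil        = ≤-refl
size-tl (cons l r) = m≤n⇒m≤1+n (m≤n+m (size r) (size l))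

idᴾ hdᴾ tlᴾ nilᴾ : PolyTime
idᴾ = record
  { ⟦_⟧ = λ v → v ; code = zero := stack ; time = λ _ → 2 ; time-poly = poly-const 2
  ; size-poly = poly-size ; runs = λ v r ρ → 2 , assign , ≤-refl }
hdᴾ = record
  { ⟦_⟧ = hd ; code = zero := consE (hdE (hdE stack)) (tlE stack)
  ; time = λ _ → 7 ; time-poly = poly-const 7
  ; size-poly = poly-≤ size-hd poly-size ; runs = λ v r ρ → 7 , assign , ≤-refl }
tlᴾ = record
  { ⟦_⟧ = tl ; code = zero := consE (tlE (hdE stack)) (tlE stack)
  ; time = λ _ → 7 ; time-poly = poly-const 7
  ; size-poly = poly-≤ size-tl poly-size ; runs = λ v r ρ → 7 , assign , ≤-refl }
nilᴾ = record
  { ⟦_⟧ = λ _ → nil ; code = zero := consE nilE (tlE stack)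
  ; time = λ _ → 5 ; time-poly = poly-const 5
  ; size-poly = poly-const 1 ; runs = λ v r ρ → 5 , assign , ≤-refl }

infixr 9 _∘ᴾ_

_∘ᴾ_ : PolyTime → PolyTime → PolyTime
⟦ F ∘ᴾ G ⟧ v            = ⟦ F ⟧ (⟦ G ⟧ v)
(F ∘ᴾ G) .code          = code G ⨾ code F
(F ∘ᴾ G) .time v        = suc (time G v + time F (⟦ G ⟧ v))
(F ∘ᴾ G) .time-poly     =
  poly-+ (poly-const 1) (poly-+ (time-poly G) (poly-∘ (time-poly F) (size-poly G)))
(F ∘ᴾ G) .size-poly     = poly-∘ (size-poly F) (size-poly G)
(F ∘ᴾ G) .runs v r ρ    with runs G v r ρ | runs F (⟦ G ⟧ v) r ρ
... | s , G⇓ , s≤ | t , F⇓ , t≤ = suc (s + t) , seq G⇓ F⇓ , s≤s (+-mono-≤ s≤ t≤)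

infix 10 ⟨_,_⟩ᴾ

⟨_,_⟩ᴾ : PolyTime → PolyTime → PolyTime
⟦ ⟨ F , G ⟩ᴾ ⟧ v         = cons (⟦ F ⟧ v) (⟦ G ⟧ v)
⟨ F , G ⟩ᴾ .code         =
  -- The stack runs through `v`, `v`, `r`; then `F v`, `v`, `r`; then `v`, `F v`, `r`; then `G v`,
  -- `F v`, `r`.
  zero := consE (hdE stack) stack ⨾ code F ⨾
  zero := consE (hdE (tlE stack)) (consE (hdE stack) (tlE (tlE stack))) ⨾ code G ⨾
  zero := consE (consE (hdE (tlE stack)) (hdE stack)) (tlE (tlE stack))
-- The constant pays for three assignments (5 + 11 + 11) and four sequencings.
⟨ F , G ⟩ᴾ .time v       = 31 + (time F v + time G v)
⟨ F , G ⟩ᴾ .time-poly    = poly-+ (poly-const 31) (poly-+ (time-poly F) (time-poly G))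
⟨ F , G ⟩ᴾ .size-poly    = poly-+ (poly-const 1) (poly-+ (size-poly F) (size-poly G))
⟨ F , G ⟩ᴾ .runs v r ρ
  with runs F v (cons v r) ρ | runs G v (cons (⟦ F ⟧ v) r) ρ
... | s , F⇓ , s≤ | t , G⇓ , t≤ =
  _ , seq assign (seq F⇓ (seq assign (seq G⇓ assign))) ,
  ≤-trans (≤-reflexive (steps s t)) (+-monoʳ-≤ 31 (+-mono-≤ s≤ t≤))
  where
  steps : ∀ s t → suc (5 + suc (s + suc (11 + suc (t + 11)))) ≡ 31 + (s + t)
  steps = solve-∀

constᴾ : Tree → PolyTime
constᴾ nil        = nilᴾ
constᴾ (cons l r) = ⟨ constᴾ l , constᴾ r ⟩ᴾ

⟦constᴾ⟧ : ∀ u v → ⟦ constᴾ u ⟧ v ≡ u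
⟦constᴾ⟧ nil        v = refl
⟦constᴾ⟧ (cons l r) v = cong₂ cons (⟦constᴾ⟧ l v) (⟦constᴾ⟧ r v)

branch : Tree → Tree → Tree → Tree
branch nil        u v = v
branch (cons _ _) u v = u

size-branch : ∀ c u v → size (branch c u v) ≤ size u + size v
size-branch nil        u v = m≤n+m (size v) (size u)
size-branch (cons _ _) u v = m≤m+n (size u) (size v)

infix 5 ifᴾ_then_else_

ifᴾ_then_else_ : PolyTime → PolyTime → PolyTime → PolyTime
⟦ ifᴾ C then F else G ⟧ v      = branch (⟦ C ⟧ v) (⟦ F ⟧ v) (⟦ G ⟧ v)
(ifᴾ C then F else G) .code    =
  zero := consE (hdE stack) stack ⨾ code C ⨾
  if hdE stack then zero := tlE stack ⨾ code F else (zero := tlE stack ⨾ code G)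
-- Both branches are charged, so the polynomial bound needs no case distinction.
(ifᴾ C then F else G) .time v  = 14 + (time C v + (time F v + time G v))
(ifᴾ C then F else G) .time-poly =
  poly-+ (poly-const 14) (poly-+ (time-poly C) (poly-+ (time-poly F) (time-poly G)))
(ifᴾ C then F else G) .size-poly =
  poly-≤ (λ v → size-branch (⟦ C ⟧ v) _ _) (poly-+ (size-poly F) (size-poly G))
(ifᴾ C then F else G) .runs v r ρ
  with ⟦ C ⟧ v | runs C v (cons v r) ρ | runs F v r ρ | runs G v r ρ
... | nil | s , C⇓ , s≤ | _ | t , G⇓ , t≤ =
  _ , seq assign (seq C⇓ (if-false refl (seq assign G⇓))) ,
  ≤-trans (≤-reflexive (steps s t))
    (+-monoʳ-≤ 14 (+-mono-≤ s≤ (≤-trans t≤ (m≤n+m _ (time F v)))))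
  where
  steps : ∀ s t → suc (5 + suc (s + suc (2 + suc (3 + t)))) ≡ 14 + (s + t)
  steps = solve-∀
... | cons _ _ | s , C⇓ , s≤ | t , F⇓ , t≤ | _ =
  _ , seq assign (seq C⇓ (if-true (λ ()) (seq assign F⇓))) ,
  ≤-trans (≤-reflexive (steps s t))
    (+-monoʳ-≤ 14 (+-mono-≤ s≤ (≤-trans t≤ (m≤m+n _ (time G v)))))
  where
  steps : ∀ s t → suc (5 + suc (s + suc (2 + suc (3 + t)))) ≡ 14 + (s + t)
  steps = solve-∀

-- Folds over lists.

-- The list is traversed by suffixes rather than by elements, so that a step
-- also sees its position, as the length of the suffix.
foldSuffixes : (Tree → Tree) → Tree → Tree → Tree → Tree
foldSuffixes f nil          env acc = acc
foldSuffixes f l@(cons _ u) env acc = foldSuffixes f u env (f (cons l (cons env acc)))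

-- Additive growth bounds the accumulator after any number of steps, whereas a
-- step that is merely polynomial in the accumulator might square it every time.
Additive : PolyTime → Set
Additive F = Σ[ h ∈ (Tree → ℕ) ] PolyBounded h ×
  (∀ l env acc → size (⟦ F ⟧ (cons l (cons env acc))) ≤ size acc + h (cons l env))

length : Tree → ℕ
length nil        = 0
length (cons _ u) = suc (length u)

length≤size : ∀ l → length l ≤ size l
length≤size nil        = z≤n
length≤size (cons x u) = s≤s (≤-trans (length≤size u) (m≤n+m (size u) (size x)))

module Fold (F : PolyTime) (additive : Additive F) where

  d e : ℕ
  d = proj₁ (time-poly F)
  e = proj₁ (proj₁ (proj₂ additive))

  -- `N` bounds the sizes of the list, the environment and the initial accumulator. The 3 is the 2
  -- of `PolyBounded` plus the root of `cons l env`.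
  growth : ℕ → ℕ
  growth N = (3 + (N + N)) ^ e

  -- The initial accumulator plus one growth per element; a list of size `N` has at most `N`
  -- elements.
  accBound : ℕ → ℕ
  accBound N = N + N * growth N

  -- 30 is the overhead of one iteration; the 4 is the 2 of `PolyBounded` plus the two `cons` nodes
  -- in the input of `F`.
  stepTime : ℕ → ℕ
  stepTime N = 30 + (4 + (N + (N + accBound N))) ^ d

  acc-growth : ∀ {N} l env acc → size l ≤ N → size env ≤ N →
               size (⟦ F ⟧ (cons l (cons env acc))) ≤ size acc + growth N
  acc-growth {N} l env acc l≤ env≤ = ≤-trans (proj₂ (proj₂ additive) l env acc)
    (+-monoʳ-≤ (size acc) (≤-trans (proj₂ (proj₁ (proj₂ additive)) (cons l env))
      (^-monoˡ-≤ e (+-monoʳ-≤ 3 (+-mono-≤ l≤ env≤)))))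

  step-time : ∀ {N} l env acc → size l ≤ N → size env ≤ N → size acc ≤ accBound N →
              30 + time F (cons l (cons env acc)) ≤ stepTime N
  step-time {N} l env acc l≤ env≤ acc≤ = +-monoʳ-≤ 30
    (≤-trans (proj₂ (time-poly F) (cons l (cons env acc))) (^-monoˡ-≤ d
      (+-monoʳ-≤ 3 (≤-trans (≤-reflexive (+-suc (size l) _))
        (s≤s (+-mono-≤ l≤ (+-mono-≤ env≤ acc≤)))))))

  loop : ∀ {m} → Cmd (suc m)
  loop = while hdE (hdE stack) loop (
    -- `F` overwrites its input, so a copy below it preserves the list and the environment for the
    -- next round.
    zero := consE (hdE stack) stack ⨾ code F ⨾
    zero := consE (consE (tlE (hdE (hdE (tlE stack))))
                         (consE (hdE (tlE (hdE (tlE stack)))) (hdE stack)))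
                  (tlE (tlE stack)))

  -- The last hypothesis is a budget: the accumulator together with one growth for every element
  -- still to come stays within `accBound N`. Hence every step can be charged the same time, which
  -- depends on `N` alone.
  loop-runs : ∀ {m} N l env acc r (ρ : Store m) → size l ≤ N → size env ≤ N →
    size acc + length l * growth N ≤ accBound N →
    ∃[ t ] ⟨ loop , cons (cons l (cons env acc)) r ∷ ρ ⟩⇓[ t ]
             (cons (cons nil (cons env (foldSuffixes ⟦ F ⟧ l env acc))) r ∷ ρ)
    × t ≤ 4 + length l * stepTime N
    × size (foldSuffixes ⟦ F ⟧ l env acc) ≤ accBound N
  loop-runs N nil env acc r ρ l≤ env≤ acc≤ =
    -- The 4 units are the final, failing test.
    4 , while-false refl , m≤m+n 4 0 , ≤-trans (≤-reflexive (sym (+-identityʳ _))) acc≤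
  loop-runs N l@(cons x u) env acc r ρ l≤ env≤ acc≤
    with runs F (cons l (cons env acc)) (cons (cons l (cons env acc)) r) ρ
       | loop-runs N u env (⟦ F ⟧ (cons l (cons env acc))) r ρ (≤-trans (size-tl l) l≤) env≤
           (≤-trans (+-monoˡ-≤ (length u * growth N) (acc-growth l env acc l≤ env≤))
             (≤-trans (≤-reflexive (+-assoc (size acc) _ _)) acc≤))
  ... | s , F⇓ , s≤ | t , loop⇓ , t≤ , size≤ =
    _ , while-true (λ ()) (seq assign (seq F⇓ assign)) loop⇓ , time≤ , size≤
    where
    open ≤-Reasoning
    steps : ∀ s t → suc (3 + ((suc (5 + suc (s + 19))) + t)) ≡ 30 + s + t
    steps = solve-∀
    time≤ : suc (3 + (suc (5 + suc (s + 19)) + t)) ≤ 4 + suc (length u) * stepTime N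
    time≤ = begin
      suc (3 + (suc (5 + suc (s + 19)) + t))  ≡⟨ steps s t ⟩
      30 + s + t                              ≤⟨ +-mono-≤ (+-monoʳ-≤ 30 s≤) t≤ ⟩
      30 + time F (cons l (cons env acc)) + (4 + length u * stepTime N)
        ≤⟨ +-monoˡ-≤ _ (step-time l env acc l≤ env≤
             (≤-trans (m≤m+n (size acc) _) acc≤)) ⟩
      stepTime N + (4 + length u * stepTime N) ≡⟨ swap (stepTime N) (length u * stepTime N) ⟩
      4 + suc (length u) * stepTime N         ∎
      where
      swap : ∀ w n → w + (4 + n) ≡ 4 + (w + n)
      swap = solve-∀

  acc-poly : PolyBounded (accBound ∘ size)
  acc-poly = poly-+ poly-size (poly-* poly-size
    (poly-^ (poly-+ (poly-const 3) (poly-+ poly-size poly-size)) e))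

  initially : ∀ {m} v r (ρ : Store m) → _
  initially v r ρ = loop-runs (size v) (hd v) (hd (tl v)) (tl (tl v)) r ρ
    (size-hd v) (≤-trans (size-hd (tl v)) (size-tl v))
    (+-mono-≤ (≤-trans (size-tl (tl v)) (size-tl v))
      (*-monoˡ-≤ (growth (size v)) (≤-trans (length≤size (hd v)) (size-hd v))))

-- The input of the fold is cons l (cons env acc).
foldᴾ : (F : PolyTime) → Additive F → PolyTime
⟦ foldᴾ F additive ⟧ v  = foldSuffixes ⟦ F ⟧ (hd v) (hd (tl v)) (tl (tl v))
foldᴾ F additive .code  =
  zero := consE (consE (hdE (hdE stack)) (consE (hdE (tlE (hdE stack))) (tlE (tlE (hdE stack))))) (tlE stack) ⨾
  Fold.loop F additive ⨾
  zero := consE (tlE (tlE (hdE stack))) (tlE stack)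
foldᴾ F additive .time v = 31 + size v * Fold.stepTime F additive (size v)
foldᴾ F additive .time-poly =
  poly-+ (poly-const 31) (poly-* poly-size (poly-+ (poly-const 30) (poly-^
    (poly-+ (poly-const 4) (poly-+ poly-size (poly-+ poly-size acc-poly))) d)))
  where open Fold F additive
foldᴾ F additive .size-poly =
  -- The size bound is a by-product of the run, here on an arbitrarily chosen rest of the stack and
  -- store.
  poly-≤ (λ v → proj₂ (proj₂ (proj₂ (initially v nil [])))) acc-poly
  where open Fold F additive
foldᴾ F additive .runs v r ρ with Fold.initially F additive v r ρ
... | t , loop⇓ , t≤ , _ = _ , seq assign (seq loop⇓ assign) , time≤
  where
  open Fold F additive
  open ≤-Reasoning
  steps : ∀ t → suc (17 + suc (t + 8)) ≡ 27 + t
  steps = solve-∀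
  time≤ : suc (17 + suc (t + 8)) ≤ 31 + size v * stepTime (size v)
  time≤ = begin
    suc (17 + suc (t + 8))                            ≡⟨ steps t ⟩
    27 + t                                            ≤⟨ +-monoʳ-≤ 27 t≤ ⟩
    31 + length (hd v) * stepTime (size v)            ≤⟨ +-monoʳ-≤ 31 (*-monoˡ-≤ (stepTime (size v))
                                                          (≤-trans (length≤size (hd v)) (size-hd v))) ⟩
    31 + size v * stepTime (size v)                   ∎

-- Lists

size≤consˡ : ∀ l env → size l ≤ size (cons l env)
size≤consˡ l env = m≤n⇒m≤1+n (m≤m+n (size l) (size env))

-- A fold step that prepends the image of the current suffix to the accumulator. The images come out
-- in reverse order, which a second fold corrects.
pushᴾ : PolyTime → PolyTime
pushᴾ F = ⟨ F ∘ᴾ ⟨ hdᴾ , hdᴾ ∘ᴾ tlᴾ ⟩ᴾ , tlᴾ ∘ᴾ tlᴾ ⟩ᴾ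

pushᴾ-additive : ∀ F → Additive (pushᴾ F)
pushᴾ-additive F = (λ v → suc (size (⟦ F ⟧ v))) , poly-+ (poly-const 1) (size-poly F) ,
  λ l env acc → ≤-reflexive (+-comm (suc (size (⟦ F ⟧ (cons l env)))) (size acc))

reverseOntoᴾ : PolyTime
reverseOntoᴾ = foldᴾ (pushᴾ (hdᴾ ∘ᴾ hdᴾ)) (pushᴾ-additive (hdᴾ ∘ᴾ hdᴾ)) ∘ᴾ ⟨ hdᴾ , ⟨ nilᴾ , tlᴾ ⟩ᴾ ⟩ᴾ

mapSuffixesOnto : (Tree → Tree) → Tree → Tree → Tree
mapSuffixesOnto g nil          w = w
mapSuffixesOnto g l@(cons _ u) w = cons (g l) (mapSuffixesOnto g u w)

abstract

  -- The input is cons l (cons env w).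
  mapSuffixesOntoᴾ : PolyTime → PolyTime
  mapSuffixesOntoᴾ F =
    reverseOntoᴾ ∘ᴾ ⟨ foldᴾ (pushᴾ F) (pushᴾ-additive F) ∘ᴾ ⟨ hdᴾ , ⟨ hdᴾ ∘ᴾ tlᴾ , nilᴾ ⟩ᴾ ⟩ᴾ
                    , tlᴾ ∘ᴾ tlᴾ ⟩ᴾ

  ⟦mapSuffixesOntoᴾ⟧ : ∀ F l env w → ⟦ mapSuffixesOntoᴾ F ⟧ (cons l (cons env w)) ≡
                       mapSuffixesOnto (λ s → ⟦ F ⟧ (cons s env)) l w
  ⟦mapSuffixesOntoᴾ⟧ F l env w = reverse-push l nil
    where
    -- For the induction the accumulator is arbitrary: what it holds ends up in front of the images
    -- still to be computed.
    reverse-push : ∀ l acc →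
      ⟦ reverseOntoᴾ ⟧ (cons (foldSuffixes ⟦ pushᴾ F ⟧ l env acc) w) ≡
      ⟦ reverseOntoᴾ ⟧ (cons acc (mapSuffixesOnto (λ s → ⟦ F ⟧ (cons s env)) l w))
    reverse-push nil          acc = refl
    reverse-push l@(cons _ u) acc = reverse-push u (cons (⟦ F ⟧ (cons l env)) acc)

infixr 5 _⊕_

_⊕_ : Tree → Tree → Tree
_⊕_ = mapSuffixesOnto hd

size-⊕ : ∀ l w → size (l ⊕ w) ≤ size l + size w
size-⊕ nil        w = n≤1+n (size w)
size-⊕ (cons x u) w = s≤s (≤-trans (+-monoʳ-≤ (size x) (size-⊕ u w))
                                   (≤-reflexive (sym (+-assoc (size x) (size u) (size w)))))

appendᴾ : PolyTime
appendᴾ = mapSuffixesOntoᴾ (hdᴾ ∘ᴾ hdᴾ) ∘ᴾ ⟨ hdᴾ , ⟨ nilᴾ , tlᴾ ⟩ᴾ ⟩ᴾ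

⟦appendᴾ⟧ : ∀ l w → ⟦ appendᴾ ⟧ (cons l w) ≡ l ⊕ w
⟦appendᴾ⟧ l w = ⟦mapSuffixesOntoᴾ⟧ (hdᴾ ∘ᴾ hdᴾ) l nil w

mapSuffixes : (Tree → Tree) → Tree → Tree
mapSuffixes g l = mapSuffixesOnto g l nil

mapSuffixesᴾ mapᴾ : PolyTime → PolyTime
mapSuffixesᴾ F = mapSuffixesOntoᴾ F ∘ᴾ ⟨ hdᴾ , ⟨ tlᴾ , nilᴾ ⟩ᴾ ⟩ᴾ
mapᴾ F         = mapSuffixesᴾ (F ∘ᴾ ⟨ hdᴾ ∘ᴾ hdᴾ , tlᴾ ⟩ᴾ)

⟦mapSuffixesᴾ⟧ : ∀ F l env → ⟦ mapSuffixesᴾ F ⟧ (cons l env) ≡ mapSuffixes (λ s → ⟦ F ⟧ (cons s env)) l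
⟦mapSuffixesᴾ⟧ F l env = ⟦mapSuffixesOntoᴾ⟧ F l env nil

-- For matrices given as lists of rows, this sets `M` beside `N`.
zipAppendOnto : Tree → Tree → Tree → Tree
zipAppendOnto nil        N w = w
zipAppendOnto (cons x M) N w = cons (x ⊕ hd N) (zipAppendOnto M (tl N) w)

-- The accumulator pairs the rows of the right matrix not yet used with the reversed output.
zipStepᴾ : PolyTime
zipStepᴾ = ⟨ tlᴾ ∘ᴾ hdᴾ ∘ᴾ acc
           , ⟨ appendᴾ ∘ᴾ ⟨ hdᴾ ∘ᴾ hdᴾ , hdᴾ ∘ᴾ hdᴾ ∘ᴾ acc ⟩ᴾ , tlᴾ ∘ᴾ acc ⟩ᴾ ⟩ᴾ
  where
  acc : PolyTime
  acc = tlᴾ ∘ᴾ tlᴾ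

size-hd+tl : ∀ v → size (hd v) + size (tl v) ≤ suc (size v)
size-hd+tl nil        = ≤-refl
size-hd+tl (cons l r) = m≤n⇒m≤1+n (n≤1+n _)

-- A row of the right matrix leaves the first half of the accumulator as it enters the second. New
-- are only the row of the left matrix, which is part of `l`, and a constant number of nodes.
zipStepᴾ-additive : Additive zipStepᴾ
zipStepᴾ-additive = (λ v → 4 + size v) , poly-+ (poly-const 4) poly-size , λ l env acc → begin
  size (⟦ zipStepᴾ ⟧ (cons l (cons env acc)))
    ≡⟨ cong (λ w → suc (size (tl (hd acc)) + suc (size w + size (tl acc))))
         (⟦appendᴾ⟧ (hd l) (hd (hd acc))) ⟩
  suc (size (tl (hd acc)) + suc (size (hd l ⊕ hd (hd acc)) + size (tl acc)))
    ≤⟨ s≤s (+-monoʳ-≤ (size (tl (hd acc))) (s≤s (+-monoˡ-≤ (size (tl acc))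
         (≤-trans (size-⊕ (hd l) (hd (hd acc)))
                  (+-monoˡ-≤ (size (hd (hd acc))) (≤-trans (size-hd l) (size≤consˡ l env))))))) ⟩
  suc (size (tl (hd acc)) + suc ((size (cons l env) + size (hd (hd acc))) + size (tl acc)))
    ≡⟨ rearrange (size (tl (hd acc))) (size (cons l env)) (size (hd (hd acc))) (size (tl acc)) ⟩
  size (hd (hd acc)) + size (tl (hd acc)) + (size (tl acc) + (2 + size (cons l env)))
    ≤⟨ +-monoˡ-≤ _ (size-hd+tl (hd acc)) ⟩
  suc (size (hd acc)) + (size (tl acc) + (2 + size (cons l env)))
    ≡⟨ +-assoc (suc (size (hd acc))) (size (tl acc)) _ ⟨
  suc (size (hd acc) + size (tl acc)) + (2 + size (cons l env))
    ≤⟨ +-monoˡ-≤ _ (s≤s (size-hd+tl acc)) ⟩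
  2 + size acc + (2 + size (cons l env))
    ≡⟨ final (size acc) (size (cons l env)) ⟩
  size acc + (4 + size (cons l env)) ∎
  where
  open ≤-Reasoning
  rearrange : ∀ a b c d → suc (a + suc ((b + c) + d)) ≡ c + a + (d + (2 + b))
  rearrange = solve-∀
  final : ∀ a b → 2 + a + (2 + b) ≡ a + (4 + b)
  final = solve-∀

abstract

  -- The input is cons M N.
  zipAppendᴾ : PolyTime
  zipAppendᴾ = reverseOntoᴾ ∘ᴾ
    ⟨ tlᴾ ∘ᴾ foldᴾ zipStepᴾ zipStepᴾ-additive ∘ᴾ ⟨ hdᴾ , ⟨ nilᴾ , ⟨ tlᴾ , nilᴾ ⟩ᴾ ⟩ᴾ ⟩ᴾ , nilᴾ ⟩ᴾ

  ⟦zipAppendᴾ⟧ : ∀ M N → ⟦ zipAppendᴾ ⟧ (cons M N) ≡ zipAppendOnto M N nil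
  ⟦zipAppendᴾ⟧ M N = reverse-zip M N nil
    where
    reverse-zip : ∀ M N out →
      ⟦ reverseOntoᴾ ⟧ (cons (tl (foldSuffixes ⟦ zipStepᴾ ⟧ M nil (cons N out))) nil) ≡
      ⟦ reverseOntoᴾ ⟧ (cons out (zipAppendOnto M N nil))
    reverse-zip nil        N out = refl
    reverse-zip (cons x M) N out = begin
      ⟦ reverseOntoᴾ ⟧ (cons (tl (foldSuffixes ⟦ zipStepᴾ ⟧ M nil
        (cons (tl N) (cons (⟦ appendᴾ ⟧ (cons x (hd N))) out)))) nil)
        ≡⟨ reverse-zip M (tl N) _ ⟩
      ⟦ reverseOntoᴾ ⟧ (cons out (cons (⟦ appendᴾ ⟧ (cons x (hd N))) (zipAppendOnto M (tl N) nil)))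
        ≡⟨ cong (λ w → ⟦ reverseOntoᴾ ⟧ (cons out (cons w (zipAppendOnto M (tl N) nil))))
             (⟦appendᴾ⟧ x (hd N)) ⟩
      ⟦ reverseOntoᴾ ⟧ (cons out (cons (x ⊕ hd N) (zipAppendOnto M (tl N) nil))) ∎
      where open ≡-Reasoning

-- Numbers in unary, as lengths of lists

branch-zero : ∀ t u v → length t ≡ 0 → branch t u v ≡ v
branch-zero nil u v _ = refl

branch-nonzero : ∀ t u v → length t ≢ 0 → branch t u v ≡ u
branch-nonzero nil        u v l≢0 = contradiction refl l≢0
branch-nonzero (cons _ _) u v _   = refl

length-encodeUnary : ∀ n → length (encodeUnary n) ≡ n
length-encodeUnary zero    = refl
length-encodeUnary (suc n) = cong suc (length-encodeUnary n)

size-encodeUnary : ∀ n → size (encodeUnary n) ≡ suc (n + n)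
size-encodeUnary zero    = refl
size-encodeUnary (suc n) = cong (λ s → suc (suc s)) (trans (size-encodeUnary n) (sym (+-suc n n)))

-- Among the lists of a given length the unary numeral is smallest; this makes halving
-- size-nonincreasing on arbitrary lists.
1+2length≤size : ∀ t → suc (length t + length t) ≤ size t
1+2length≤size nil        = ≤-refl
1+2length≤size (cons x u) = s≤s (≤-trans (≤-reflexive (cong suc (+-suc (length u) (length u)))) (+-mono-≤ (size>0 x) (1+2length≤size u)))
  where
  size>0 : ∀ t → 1 ≤ size t
  size>0 nil        = ≤-refl
  size>0 (cons _ _) = s≤s z≤n

length-tl : ∀ t → length (tl t) ≡ length t ∸ 1
length-tl nil        = refl
length-tl (cons _ _) = refl

tailAccᴾ : PolyTime
tailAccᴾ = tlᴾ ∘ᴾ tlᴾ ∘ᴾ tlᴾ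

abstract

  -- Each element of the first list removes one from the second, so lengths are subtracted. An empty
  -- result says that the second list is no longer than the first.
  dropᴾ : PolyTime
  dropᴾ = foldᴾ tailAccᴾ tailAcc-additive ∘ᴾ ⟨ hdᴾ , ⟨ nilᴾ , tlᴾ ⟩ᴾ ⟩ᴾ
    where
    tailAcc-additive : Additive tailAccᴾ
    tailAcc-additive = (λ _ → 0) , poly-const 0 , λ l env acc →
      ≤-trans (size-tl acc) (≤-reflexive (sym (+-identityʳ _)))

  length-dropᴾ : ∀ l s → length (⟦ dropᴾ ⟧ (cons l s)) ≡ length s ∸ length l
  length-dropᴾ nil        s = refl
  length-dropᴾ (cons x u) s = begin
    length (⟦ dropᴾ ⟧ (cons u (tl s))) ≡⟨ length-dropᴾ u (tl s) ⟩
    length (tl s) ∸ length u           ≡⟨ cong (_∸ length u) (length-tl s) ⟩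
    length s ∸ 1 ∸ length u            ≡⟨ ∸-+-assoc (length s) 1 (length u) ⟩
    length s ∸ suc (length u)          ∎
    where open ≡-Reasoning

-- The accumulator is a parity flag followed by the part of the half built so far.
halfStepᴾ : PolyTime
halfStepᴾ = ifᴾ hdᴾ ∘ᴾ acc then ⟨ nilᴾ , ⟨ nilᴾ , tlᴾ ∘ᴾ acc ⟩ᴾ ⟩ᴾ
                            else ⟨ constᴾ (encodeBool true) , tlᴾ ∘ᴾ acc ⟩ᴾ
  where
  acc : PolyTime
  acc = tlᴾ ∘ᴾ tlᴾ

halfStepᴾ-additive : Additive halfStepᴾ
halfStepᴾ-additive = (λ _ → 4) , poly-const 4 , λ l env acc → bound (hd acc) acc
  where
  bound : ∀ c acc → size (branch c (cons nil (cons nil (tl acc))) (cons (encodeBool true) (tl acc)))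
                    ≤ size acc + 4
  bound c acc = ≤-trans (lemma c) (≤-trans (+-monoʳ-≤ 4 (size-tl acc)) (≤-reflexive (+-comm 4 _)))
    where
    lemma : ∀ c → size (branch c (cons nil (cons nil (tl acc))) (cons (encodeBool true) (tl acc)))
                  ≤ 4 + size (tl acc)
    lemma nil        = ≤-refl
    lemma (cons _ _) = ≤-refl

abstract

  halfᴾ : PolyTime
  halfᴾ = tlᴾ ∘ᴾ foldᴾ halfStepᴾ halfStepᴾ-additive ∘ᴾ ⟨ idᴾ , ⟨ nilᴾ , nilᴾ ⟩ᴾ ⟩ᴾ

  ⟦halfᴾ⟧ : ∀ t → ⟦ halfᴾ ⟧ t ≡ encodeUnary ⌊ length t /2⌋
  ⟦halfᴾ⟧ nil               = refl
  ⟦halfᴾ⟧ (cons _ nil)      = refl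
  ⟦halfᴾ⟧ (cons _ (cons _ t)) = trans (halve t 1) (cong encodeUnary (+-comm ⌊ length t /2⌋ 1))
    where
    halve : ∀ t j → tl (foldSuffixes ⟦ halfStepᴾ ⟧ t nil (cons nil (encodeUnary j))) ≡
                    encodeUnary (⌊ length t /2⌋ + j)
    halve nil                 j = refl
    halve (cons _ nil)        j = refl
    halve (cons _ (cons _ t)) j = trans (halve t (suc j)) (cong encodeUnary (+-suc ⌊ length t /2⌋ j))

  length-halfᴾ : ∀ t → length (⟦ halfᴾ ⟧ t) ≡ ⌊ length t /2⌋
  length-halfᴾ t = trans (cong length (⟦halfᴾ⟧ t)) (length-encodeUnary _)

size-halfᴾ : ∀ t → size (⟦ halfᴾ ⟧ t) ≤ size t
size-halfᴾ t = begin
  size (⟦ halfᴾ ⟧ t)                   ≡⟨ cong size (⟦halfᴾ⟧ t) ⟩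
  size (encodeUnary ⌊ length t /2⌋)    ≡⟨ size-encodeUnary _ ⟩
  suc (⌊ length t /2⌋ + ⌊ length t /2⌋) ≤⟨ s≤s (+-mono-≤ (⌊n/2⌋≤n (length t)) (⌊n/2⌋≤n (length t))) ⟩
  suc (length t + length t)            ≤⟨ 1+2length≤size t ⟩
  size t                               ∎
  where open ≤-Reasoning

-- Comparison of a unary number r with a binary number: r ≤ 1 + 2 m iff
-- ⌊ r /2⌋ ≤ m, and r ≤ 2 + 2 m iff ⌊ r - 1 /2⌋ ≤ m.

excessStepᴾ : PolyTime
excessStepᴾ = ifᴾ hdᴾ ∘ᴾ hdᴾ then halfᴾ ∘ᴾ tailAccᴾ else halfᴾ ∘ᴾ tlᴾ ∘ᴾ tlᴾ

excessStepᴾ-additive : Additive excessStepᴾ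
excessStepᴾ-additive = (λ _ → 0) , poly-const 0 , λ l env acc →
  ≤-trans (bound (hd l) acc) (≤-reflexive (sym (+-identityʳ _)))
  where
  bound : ∀ c acc → size (branch c (⟦ halfᴾ ⟧ (tl acc)) (⟦ halfᴾ ⟧ acc)) ≤ size acc
  bound nil        acc = size-halfᴾ acc
  bound (cons _ _) acc = ≤-trans (size-halfᴾ (tl acc)) (size-tl acc)

-- The input is cons digits r; the output is empty iff r is at most the number.
excessᴾ : PolyTime
excessᴾ = foldᴾ excessStepᴾ excessStepᴾ-additive ∘ᴾ ⟨ hdᴾ , ⟨ nilᴾ , tlᴾ ⟩ᴾ ⟩ᴾ

⌊r/2⌋≤m⇒r≤1+2m : ∀ r m → ⌊ r /2⌋ ≤ m → r ≤ suc (2 * m)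
⌊r/2⌋≤m⇒r≤1+2m zero          m       _        = z≤n
⌊r/2⌋≤m⇒r≤1+2m (suc zero)    m       _        = s≤s z≤n
⌊r/2⌋≤m⇒r≤1+2m (suc (suc r)) (suc m) (s≤s le) =
  ≤-trans (s≤s (s≤s (⌊r/2⌋≤m⇒r≤1+2m r m le))) (≤-reflexive (cong suc (sym (*-suc 2 m))))

r≤1+2m⇒⌊r/2⌋≤m : ∀ r m → r ≤ suc (2 * m) → ⌊ r /2⌋ ≤ m
r≤1+2m⇒⌊r/2⌋≤m zero          m       _        = z≤n
r≤1+2m⇒⌊r/2⌋≤m (suc zero)    m       _        = z≤n
r≤1+2m⇒⌊r/2⌋≤m (suc (suc r)) zero    (s≤s ())
r≤1+2m⇒⌊r/2⌋≤m (suc (suc r)) (suc m) (s≤s le) =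
  s≤s (r≤1+2m⇒⌊r/2⌋≤m r m (s≤s⁻¹ (≤-trans le (≤-reflexive (*-suc 2 m)))))

excessᴾ-sound : ∀ u r → length (⟦ excessᴾ ⟧ (cons (encodeℕᵇ u) r)) ≡ 0 → length r ≤ ℕᵇ.toℕ u
excessᴾ-sound ℕᵇ.zero  r eq = ≤-reflexive eq
excessᴾ-sound 2[1+ u ] r eq =
  ≤-trans (≤-trans (m≤n+m∸n (length r) 1) (+-monoʳ-≤ 1 (≤-trans (≤-reflexive (sym (length-tl r)))
    (⌊r/2⌋≤m⇒r≤1+2m (length (tl r)) _
      (subst (_≤ _) (length-halfᴾ (tl r)) (excessᴾ-sound u (⟦ halfᴾ ⟧ (tl r)) eq))))))
    (≤-reflexive (sym (*-suc 2 (ℕᵇ.toℕ u))))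
excessᴾ-sound 1+[2 u ] r eq =
  ⌊r/2⌋≤m⇒r≤1+2m (length r) _ (subst (_≤ _) (length-halfᴾ r) (excessᴾ-sound u (⟦ halfᴾ ⟧ r) eq))

excessᴾ-complete : ∀ u r → length r ≤ ℕᵇ.toℕ u → length (⟦ excessᴾ ⟧ (cons (encodeℕᵇ u) r)) ≡ 0
excessᴾ-complete ℕᵇ.zero  r le = n≤0⇒n≡0 le
excessᴾ-complete 2[1+ u ] r le = excessᴾ-complete u (⟦ halfᴾ ⟧ (tl r))
  (subst (_≤ _) (sym (length-halfᴾ (tl r))) (r≤1+2m⇒⌊r/2⌋≤m (length (tl r)) _
    (≤-trans (≤-reflexive (length-tl r)) (m≤n+o⇒m∸n≤o (length r) 1
      (≤-trans le (≤-reflexive (*-suc 2 (ℕᵇ.toℕ u))))))))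
excessᴾ-complete 1+[2 u ] r le = excessᴾ-complete u (⟦ halfᴾ ⟧ r)
  (subst (_≤ _) (sym (length-halfᴾ r)) (r≤1+2m⇒⌊r/2⌋≤m (length r) _ le))

-- The integers sgn z are spread over the positions r = 1, …, ∣ z ∣ and shifted by one.
shiftedSign : ℕ → ℤ → ℕ
shiftedSign r z with r ≤? ∣ z ∣
shiftedSign r z        | no  _ = 1
shiftedSign r (+ _)    | yes _ = 2
shiftedSign r -[1+ _ ] | yes _ = 0

abstract

  -- The input is cons z r.
  shiftedSignᴾ : PolyTime
  shiftedSignᴾ =
    ifᴾ excessᴾ ∘ᴾ ⟨ tlᴾ ∘ᴾ hdᴾ , tlᴾ ⟩ᴾ then constᴾ (encodeℤ (+ 1))
    else (ifᴾ hdᴾ ∘ᴾ hdᴾ then constᴾ (encodeℤ (+ 0)) else constᴾ (encodeℤ (+ 2)))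

  ⟦shiftedSignᴾ⟧ : ∀ z r → ⟦ shiftedSignᴾ ⟧ (cons (encodeℤ z) r) ≡ encodeℤ (+ shiftedSign (length r) z)
  ⟦shiftedSignᴾ⟧ z r with length r ≤? ∣ z ∣
  ⟦shiftedSignᴾ⟧ (+ m) r | yes r≤ =
    branch-zero (⟦ excessᴾ ⟧ (cons (encodeℕᵇ (ℕᵇ.fromℕ m)) r)) _ _
      (excessᴾ-complete (ℕᵇ.fromℕ m) r (subst (length r ≤_) (sym (ℕᵇ.toℕ-fromℕ m)) r≤))
  ⟦shiftedSignᴾ⟧ (+ m) r | no r≰ =
    branch-nonzero (⟦ excessᴾ ⟧ (cons (encodeℕᵇ (ℕᵇ.fromℕ m)) r)) _ _
      (λ eq → r≰ (subst (length r ≤_) (ℕᵇ.toℕ-fromℕ m) (excessᴾ-sound (ℕᵇ.fromℕ m) r eq)))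
  ⟦shiftedSignᴾ⟧ -[1+ m ] r | yes r≤ =
    branch-zero (⟦ excessᴾ ⟧ (cons (encodeℕᵇ (ℕᵇ.fromℕ (suc m))) r)) _ _
      (excessᴾ-complete (ℕᵇ.fromℕ (suc m)) r (subst (length r ≤_) (sym (ℕᵇ.toℕ-fromℕ (suc m))) r≤))
  ⟦shiftedSignᴾ⟧ -[1+ m ] r | no r≰ =
    branch-nonzero (⟦ excessᴾ ⟧ (cons (encodeℕᵇ (ℕᵇ.fromℕ (suc m))) r)) _ _
      (λ eq → r≰ (subst (length r ≤_) (ℕᵇ.toℕ-fromℕ (suc m)) (excessᴾ-sound (ℕᵇ.fromℕ (suc m)) r eq)))

-- Block vectors and block matrices

flatten : ∀ {p k} {U : Set} → Vector (Vector U k) p → Vector U (p * k)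
flatten {k = k} v i = uncurry v (remQuot k i)

flatten-combine : ∀ {p k} {U : Set} (v : Vector (Vector U k) p) a i → flatten v (combine a i) ≡ v a i
flatten-combine v a i = cong (uncurry v) (Fin.remQuot-combine a i)

blockMatrix : ∀ {p k} → Vector (Vector (Matrix k) p) p → Matrix (p * k)
blockMatrix M = flatten λ a i → flatten λ b → M a b i

∀-combine : ∀ {p k} {Q : Fin (p * k) → Set} → (∀ (a : Fin p) i → Q (combine a i)) → ∀ i → Q i
∀-combine {p} {k} {Q} q i = subst Q (Fin.combine-remQuot {p} k i) (uncurry q (remQuot k i))

∑-↑ : ∀ m n (f : Fin (m + n) → ℤ) →
      ∑[ i < m + n ] f i ≡ ∑[ i < m ] f (i ↑ˡ n) ℤ.+ ∑[ i < n ] f (m ↑ʳ i)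
∑-↑ zero    n f = sym (ℤ.+-identityˡ _)
∑-↑ (suc m) n f = trans (cong (f zero +ℤ_) (∑-↑ m n (f ∘ suc))) (sym (ℤ.+-assoc (f zero) _ _))

∑-combine : ∀ p k (f : Fin (p * k) → ℤ) →
            ∑[ i < p * k ] f i ≡ ∑[ a < p ] ∑[ i < k ] f (combine a i)
∑-combine zero    k f = refl
∑-combine (suc p) k f = trans (∑-↑ k (p * k) f)
  (cong (∑[ i < k ] f (i ↑ˡ (p * k)) +ℤ_) (∑-combine p k (f ∘ (k ↑ʳ_))))

blockMatrix-· : ∀ {p k} (M : Vector (Vector (Matrix k) p) p) v a i →
                (blockMatrix M · v) (combine a i) ≡ ∑[ b < p ] ((M a b · (v ∘ combine b)) i)
blockMatrix-· {p} {k} M v a i = trans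
  (∑-combine p k _)
  (sum-cong-≗ λ b → sum-cong-≗ λ j → cong (ℤ._* + v (combine b j))
    (trans (cong (λ row → row (combine b j)) (flatten-combine (λ a i → flatten λ b → M a b i) a i))
           (flatten-combine (λ b → M a b i) b j)))

·-congʳ : ∀ {k} (M : Matrix k) {v w : Vector ℕ k} → (∀ j → v j ≡ w j) → ∀ i → (M · v) i ≡ (M · w) i
·-congʳ M v≗w i = sum-cong-≗ λ j → cong (λ e → M i j ℤ.* + e) (v≗w j)

∑-neg : ∀ {n} (f : Fin n → ℤ) → ∑[ i < n ] (ℤ.- f i) ≡ ℤ.- (∑[ i < n ] f i)
∑-neg {zero}  f = refl
∑-neg {suc n} f = trans (cong (-ℤ f zero +ℤ_) (∑-neg (f ∘ suc))) (sym (ℤ.neg-distrib-+ (f zero) _))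

∑-distrib-- : ∀ {n} (f g : Fin n → ℤ) →
              ∑[ i < n ] (f i ℤ.- g i) ≡ ∑[ i < n ] f i ℤ.- ∑[ i < n ] g i
∑-distrib-- {n} f g = trans (∑-distrib-+ f (-ℤ_ ∘ g)) (cong (∑[ i < n ] f i +ℤ_) (∑-neg g))

∑-pos : ∀ {n} (f : Fin n → ℕ) → ∑[ i < n ] (+ f i) ≡ + ℕ-Sum.sum f
∑-pos {zero}  f = refl
∑-pos {suc n} f = cong (+ f zero +ℤ_) (∑-pos (f ∘ suc))

total : ∀ {k} → Vector ℕ k → ℤ
total v = sum (+_ ∘ v)

-- Spreading a matrix over the blocks

-- The positions `n ∸ toℕ t` run down from n to 1, and each of the `n ⊓ m` positions up to m
-- contributes 1. Counting down agrees with the lengths of suffixes, from which the reduction reads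
-- off a position.
∑-shiftedSign-pos : ∀ n m → ∑[ t < n ] (+ shiftedSign (n ∸ toℕ t) (+ m) ℤ.- 1ℤ) ≡ + (n ⊓ m)
∑-shiftedSign-pos zero    m = refl
∑-shiftedSign-pos (suc n) m with suc n ≤? m
... | yes n<m = trans (cong (1ℤ +ℤ_) (∑-shiftedSign-pos n m))
                      (cong +_ (trans (cong suc (m≤n⇒m⊓n≡m (<⇒≤ n<m))) (sym (m≤n⇒m⊓n≡m n<m))))
... | no  n≮m = trans (cong (0ℤ +ℤ_) (∑-shiftedSign-pos n m))
                      (cong +_ (trans (m≥n⇒m⊓n≡n (≮⇒≥ n≮m)) (sym (m≥n⇒m⊓n≡n (m≤n⇒m≤1+n (≮⇒≥ n≮m))))))

shiftedSign-neg : ∀ r m → + shiftedSign r -[1+ m ] ℤ.- 1ℤ ≡ ℤ.- (+ shiftedSign r (+ suc m) ℤ.- 1ℤ)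
shiftedSign-neg r m with r ≤? suc m
... | yes _ = refl
... | no  _ = refl

-- The bound on the entries enters here: with at most one unit per block, n blocks represent the
-- integers of absolute value up to n.
∑-shiftedSign : ∀ n z → ∣ z ∣ ≤ n → ∑[ t < n ] (+ shiftedSign (n ∸ toℕ t) z ℤ.- 1ℤ) ≡ z
∑-shiftedSign n (+ m)    m≤n = trans (∑-shiftedSign-pos n m) (cong +_ (m≥n⇒m⊓n≡n m≤n))
∑-shiftedSign n -[1+ m ] m<n = trans
  (sum-cong-≗ {n} λ t → shiftedSign-neg (n ∸ toℕ t) m)
  (trans (∑-neg {n} _) (cong -ℤ_ (∑-shiftedSign n (+ suc m) m<n)))

shiftedSignMatrix : ∀ {k} → ℕ → Matrix k → Matrix k
shiftedSignMatrix r M i j = + shiftedSign r (M i j)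

-- `total x` is an entry of the all-ones matrix times x, so subtracting it undoes the shift. After
-- exchanging the sums, the signs add up to each entry of `M`.
∑-shiftedSignMatrix : ∀ {n k} (M : Matrix k) → (∀ i j → ∣ M i j ∣ ≤ n) → ∀ x i →
  ∑[ t < n ] ((shiftedSignMatrix (n ∸ toℕ t) M · x) i ℤ.- total x) ≡ (M · x) i
∑-shiftedSignMatrix {n} {k} M bounded x i = begin
  ∑[ t < n ] ((M̂ t · x) i ℤ.- total x)
    ≡⟨ sum-cong-≗ {n} (λ t → trans (sym (∑-distrib-- (λ j → M̂ t i j ℤ.* + x j) (+_ ∘ x)))
                                    (sum-cong-≗ λ j → factor (M̂ t i j) (+ x j))) ⟩
  ∑[ t < n ] ∑[ j < k ] ((M̂ t i j ℤ.- 1ℤ) ℤ.* + x j)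
    ≡⟨ ∑-comm (λ (t : Fin n) j → (M̂ t i j ℤ.- 1ℤ) ℤ.* + x j) ⟩
  ∑[ j < k ] ∑[ t < n ] ((M̂ t i j ℤ.- 1ℤ) ℤ.* + x j)
    ≡⟨ sum-cong-≗ (λ j → sym (*-distribʳ-sum (+ x j) (λ (t : Fin n) → M̂ t i j ℤ.- 1ℤ))) ⟩
  ∑[ j < k ] ((∑[ t < n ] (M̂ t i j ℤ.- 1ℤ)) ℤ.* + x j)
    ≡⟨ sum-cong-≗ (λ j → cong (ℤ._* + x j) (∑-shiftedSign n (M i j) (bounded i j))) ⟩
  (M · x) i ∎
  where
  open ≡-Reasoning
  M̂ : Fin n → Matrix k
  M̂ t = shiftedSignMatrix (n ∸ toℕ t) M
  factor : ∀ m y → m ℤ.* y ℤ.- y ≡ (m ℤ.- 1ℤ) ℤ.* y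
  factor = ℤ-Solver.solve-∀

-- The reduced program

-- The letters stand for 0, the identity, its negative, its double, and minus the all-ones matrix.
data Block (S : Set) : Set where
  O I N T J : Block S
  source    : S → Block S

data Source : Set where
  A̲ B̲ C̲ D̲ : Source

Layout : Set → Set
Layout S = Vec (Vec (Block S) 5) 5

-- The blocks of shared variables are x, s = ∑ yₜ, u⁺, u⁻ with u⁺ - u⁻ = A x,
-- and a dummy; the local ones are y, copies of x and s, B̂ x + Ĉ s and Â x,
-- with Â, B̂, Ĉ the t-th shifted sign matrices of A, B, C.
-- The entries 2 keep Δ independent of whether all D are zero.
layoutA layoutB layoutC : Layout ⊥
layoutA =
  (O ∷ O ∷ I ∷ N ∷ O ∷ []) ∷
  (I ∷ O ∷ O ∷ O ∷ O ∷ []) ∷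
  (O ∷ I ∷ O ∷ O ∷ O ∷ []) ∷
  (O ∷ O ∷ O ∷ O ∷ O ∷ []) ∷
  (O ∷ O ∷ O ∷ O ∷ O ∷ []) ∷ []
layoutB =
  (O ∷ O ∷ O ∷ O ∷ O ∷ []) ∷
  (O ∷ O ∷ N ∷ I ∷ O ∷ []) ∷
  (O ∷ N ∷ O ∷ O ∷ O ∷ []) ∷
  (O ∷ O ∷ O ∷ O ∷ T ∷ []) ∷
  (O ∷ O ∷ O ∷ O ∷ O ∷ []) ∷ []
layoutC =
  (O ∷ J ∷ J ∷ I ∷ O ∷ []) ∷
  (O ∷ J ∷ O ∷ O ∷ I ∷ []) ∷
  (I ∷ O ∷ O ∷ O ∷ O ∷ []) ∷
  (O ∷ O ∷ O ∷ O ∷ O ∷ []) ∷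
  (O ∷ O ∷ O ∷ O ∷ O ∷ []) ∷ []

layoutD : Layout Source
layoutD =
  (source D̲ ∷ O        ∷ O        ∷ O ∷ O ∷ []) ∷
  (O        ∷ N        ∷ O        ∷ O ∷ O ∷ []) ∷
  (O        ∷ O        ∷ N        ∷ O ∷ O ∷ []) ∷
  (O        ∷ source B̲ ∷ source C̲ ∷ N ∷ O ∷ []) ∷
  (O        ∷ source A̲ ∷ O        ∷ O ∷ N ∷ []) ∷ []

scalarMatrix : ∀ {k} → ℤ → ℤ → Matrix k
scalarMatrix c d i j = ifᵇ does (i Fin.≟ j) then c else d

block : ∀ {k S} → (S → Matrix k) → Block S → Matrix k
block M O          = scalarMatrix 0ℤ 0ℤ
block M I          = scalarMatrix 1ℤ 0ℤ
block M N          = scalarMatrix -1ℤ 0ℤ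
block M T          = scalarMatrix (+ 2) 0ℤ
block M J          = scalarMatrix -1ℤ -1ℤ
block M (source s) = M s

noSource : ∀ {k} → ⊥ → Matrix k
noSource ()

fill : ∀ {k S} → (S → Matrix k) → Layout S → Vector (Vector (Matrix k) 5) 5
fill M L a b = block M (lookup (lookup L a) b)

sourceMatrix : ∀ {n k} → FourBlock n k → Fin n → Source → Matrix k
sourceMatrix {n} P t A̲ = shiftedSignMatrix (n ∸ toℕ t) (A P)
sourceMatrix {n} P t B̲ = shiftedSignMatrix (n ∸ toℕ t) (B P)
sourceMatrix {n} P t C̲ = shiftedSignMatrix (n ∸ toℕ t) (C P)
sourceMatrix     P t D̲ = D P t

padded : ∀ {k} → Vector ℤ k → Vector (Vector ℤ k) 5
padded v zero    = v
padded v (suc _) = λ _ → 0ℤ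

reduced : ∀ {n k} → FourBlock n k → FourBlock n (5 * k)
reduced {k = k} P .A   = blockMatrix {k = k} (fill noSource layoutA)
reduced {k = k} P .B   = blockMatrix {k = k} (fill noSource layoutB)
reduced {k = k} P .C   = blockMatrix {k = k} (fill noSource layoutC)
reduced P .D t = blockMatrix (fill (sourceMatrix P t) layoutD)
reduced P .a   = flatten (padded (a P))
reduced P .b t = flatten (padded (b P t))

-- The matrix is c - d times the identity plus d times the all-ones matrix.
scalarMatrix-· : ∀ {k} c d (v : Vector ℕ k) i →
                 (scalarMatrix c d · v) i ≡ (c ℤ.- d) ℤ.* + v i ℤ.+ d ℤ.* total v
scalarMatrix-· c d v zero    =
  trans (cong (c ℤ.* + v zero +ℤ_) (sym (*-distribˡ-sum d (+_ ∘ v ∘ suc)))) (first c d (+ v zero) _)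
  where
  first : ∀ c d v₀ s → c ℤ.* v₀ ℤ.+ d ℤ.* s ≡ (c ℤ.- d) ℤ.* v₀ ℤ.+ d ℤ.* (v₀ ℤ.+ s)
  first = ℤ-Solver.solve-∀
scalarMatrix-· c d v (suc i) =
  trans (cong (d ℤ.* + v zero +ℤ_) (scalarMatrix-· c d (v ∘ suc) i))
        (later c d (+ v zero) (+ v (suc i)) (total (v ∘ suc)))
  where
  later : ∀ c d v₀ vᵢ s → d ℤ.* v₀ ℤ.+ ((c ℤ.- d) ℤ.* vᵢ ℤ.+ d ℤ.* s) ≡
                          (c ℤ.- d) ℤ.* vᵢ ℤ.+ d ℤ.* (v₀ ℤ.+ s)
  later = ℤ-Solver.solve-∀

-- Products in simplified form, so that each row of a concrete layout unfolds to an explicit ring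
-- expression.
blockRow : ∀ {k S} → (S → Matrix k) → Block S → Vector ℕ k → Fin k → ℤ
blockRow M O          v i = 0ℤ
blockRow M I          v i = + v i
blockRow M N          v i = ℤ.- + v i
blockRow M T          v i = + 2 ℤ.* + v i
blockRow M J          v i = ℤ.- total v
blockRow M (source s) v i = (M s · v) i

block-· : ∀ {k S} (M : S → Matrix k) X v i → (block M X · v) i ≡ blockRow M X v i
block-· M O v i = trans (scalarMatrix-· 0ℤ 0ℤ v i) (zeros (+ v i) (total v))
  where
  zeros : ∀ x s → (0ℤ ℤ.- 0ℤ) ℤ.* x ℤ.+ 0ℤ ℤ.* s ≡ 0ℤ
  zeros = ℤ-Solver.solve-∀
block-· M I v i = trans (scalarMatrix-· 1ℤ 0ℤ v i) (identity (+ v i) (total v))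
  where
  identity : ∀ x s → (1ℤ ℤ.- 0ℤ) ℤ.* x ℤ.+ 0ℤ ℤ.* s ≡ x
  identity = ℤ-Solver.solve-∀
block-· M N v i = trans (scalarMatrix-· -1ℤ 0ℤ v i) (negation (+ v i) (total v))
  where
  negation : ∀ x s → (-1ℤ ℤ.- 0ℤ) ℤ.* x ℤ.+ 0ℤ ℤ.* s ≡ ℤ.- x
  negation = ℤ-Solver.solve-∀
block-· M T v i = trans (scalarMatrix-· (+ 2) 0ℤ v i) (twice (+ v i) (total v))
  where
  twice : ∀ x s → (+ 2 ℤ.- 0ℤ) ℤ.* x ℤ.+ 0ℤ ℤ.* s ≡ + 2 ℤ.* x
  twice = ℤ-Solver.solve-∀
block-· M J v i = trans (scalarMatrix-· -1ℤ -1ℤ v i) (negatedTotal (+ v i) (total v))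
  where
  negatedTotal : ∀ x s → (-1ℤ ℤ.- -1ℤ) ℤ.* x ℤ.+ -1ℤ ℤ.* s ≡ ℤ.- s
  negatedTotal = ℤ-Solver.solve-∀
block-· M (source s) v i = refl

layoutRow : ∀ {k S} → (S → Matrix k) → Layout S → Fin 5 → Vector (Vector ℕ k) 5 → Fin k → ℤ
layoutRow M L a V i = ∑[ b < 5 ] blockRow M (lookup (lookup L a) b) (V b) i

fill-· : ∀ {k S} (M : S → Matrix k) (L : Layout S) v a i →
         (blockMatrix (fill M L) · v) (combine a i) ≡ layoutRow M L a (λ b → v ∘ combine b) i
fill-· M L v a i = trans (blockMatrix-· (fill M L) v a i)
  (sum-cong-≗ {5} λ b → block-· M (lookup (lookup L a) b) (v ∘ combine b) i)

-- The reduced program as a system of block equations.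

module _ {n k : ℕ} (P : FourBlock n k) where

  link : Vector (Vector ℕ k) 5 → Vector (Vector (Vector ℕ k) 5) n → Fin 5 → Fin k → ℤ
  link X Y a i = layoutRow noSource layoutB a X i ℤ.+ ∑[ t < n ] layoutRow noSource layoutC a (Y t) i

  local : Vector (Vector ℕ k) 5 → Vector (Vector (Vector ℕ k) 5) n → Fin n → Fin 5 → Fin k → ℤ
  local X Y t a i = layoutRow noSource layoutA a X i ℤ.+ layoutRow (sourceMatrix P t) layoutD a (Y t) i

  -- `link₀` collects the local results, freed of the shift, into the equation for `a`; `link₁` says
  -- u⁺ - u⁻ = A x, `link₂` defines s, and `link₃` makes the dummy zero. `local₀` is the old local
  -- equation with u⁺ - u⁻ for A x; the others define the copies and the local results. The last
  -- shared row reads 0 = 0 and has no field.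
  record Solves (X : Vector (Vector ℕ k) 5) (Y : Vector (Vector (Vector ℕ k) 5) n) : Set where
    field
      link₀  : ∀ i → ∑[ t < n ] (+ Y t 3F i ℤ.- (total (Y t 1F) ℤ.+ total (Y t 2F))) ≡ a P i
      link₁  : ∀ i → ∑[ t < n ] (+ Y t 4F i ℤ.- total (Y t 1F)) ≡ + X 2F i ℤ.- + X 3F i
      link₂  : ∀ i → ∑[ t < n ] (+ Y t 0F i) ≡ + X 1F i
      link₃  : ∀ i → + 2 ℤ.* + X 4F i ≡ 0ℤ
      local₀ : ∀ t i → (+ X 2F i ℤ.- + X 3F i) ℤ.+ (D P t · Y t 0F) i ≡ b P t i
      local₁ : ∀ t i → + X 0F i ≡ + Y t 1F i
      local₂ : ∀ t i → + X 1F i ≡ + Y t 2F i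
      local₃ : ∀ t i → (sourceMatrix P t B̲ · Y t 1F) i ℤ.+ (sourceMatrix P t C̲ · Y t 2F) i ≡ + Y t 3F i
      local₄ : ∀ t i → (sourceMatrix P t A̲ · Y t 1F) i ≡ + Y t 4F i

  module _ (X : Vector (Vector ℕ k) 5) (Y : Vector (Vector (Vector ℕ k) 5) n) where

    link₀-≡ : ∀ i → link X Y 0F i ≡
              ∑[ t < n ] (+ Y t 3F i ℤ.- (total (Y t 1F) ℤ.+ total (Y t 2F)))
    link₀-≡ i = trans (ℤ.+-identityˡ _) (sum-cong-≗ {n} λ t → row (total (Y t 1F)) (total (Y t 2F)) (+ Y t 3F i))
      where
      row : ∀ x s p → 0ℤ ℤ.+ (ℤ.- x ℤ.+ (ℤ.- s ℤ.+ (p ℤ.+ (0ℤ ℤ.+ 0ℤ)))) ≡ p ℤ.- (x ℤ.+ s)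
      row = ℤ-Solver.solve-∀

    link₁-≡ : ∀ i → link X Y 1F i ≡
              ∑[ t < n ] (+ Y t 4F i ℤ.- total (Y t 1F)) ℤ.- (+ X 2F i ℤ.- + X 3F i)
    link₁-≡ i = trans (cong (layoutRow noSource layoutB 1F X i +ℤ_) (sum-cong-≗ {n} λ t → row (total (Y t 1F)) (+ Y t 4F i)))
                      (final (+ X 2F i) (+ X 3F i) _)
      where
      row : ∀ x q → 0ℤ ℤ.+ (ℤ.- x ℤ.+ (0ℤ ℤ.+ (0ℤ ℤ.+ (q ℤ.+ 0ℤ)))) ≡ q ℤ.- x
      row = ℤ-Solver.solve-∀
      final : ∀ u⁺ u⁻ z → (0ℤ ℤ.+ (0ℤ ℤ.+ (ℤ.- u⁺ ℤ.+ (u⁻ ℤ.+ (0ℤ ℤ.+ 0ℤ))))) ℤ.+ z ≡ z ℤ.- (u⁺ ℤ.- u⁻)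
      final = ℤ-Solver.solve-∀

    link₂-≡ : ∀ i → link X Y 2F i ≡ ∑[ t < n ] (+ Y t 0F i) ℤ.- + X 1F i
    link₂-≡ i = trans (cong (layoutRow noSource layoutB 2F X i +ℤ_) (sum-cong-≗ {n} λ t → ℤ.+-identityʳ (+ Y t 0F i)))
                      (final (+ X 1F i) _)
      where
      final : ∀ s z → (0ℤ ℤ.+ (ℤ.- s ℤ.+ (0ℤ ℤ.+ (0ℤ ℤ.+ (0ℤ ℤ.+ 0ℤ))))) ℤ.+ z ≡ z ℤ.- s
      final = ℤ-Solver.solve-∀

    link₃-≡ : ∀ i → link X Y 3F i ≡ + 2 ℤ.* + X 4F i
    link₃-≡ i = trans (cong (layoutRow noSource layoutB 3F X i +ℤ_) (sum-replicate-zero n)) (final (+ 2 ℤ.* + X 4F i))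
      where
      final : ∀ z → (0ℤ ℤ.+ (0ℤ ℤ.+ (0ℤ ℤ.+ (0ℤ ℤ.+ (z ℤ.+ 0ℤ))))) ℤ.+ 0ℤ ≡ z
      final = ℤ-Solver.solve-∀

    link₄-≡ : ∀ i → link X Y 4F i ≡ 0ℤ
    link₄-≡ i = trans (cong (layoutRow noSource layoutB 4F X i +ℤ_) (sum-replicate-zero n)) refl

    local₀-≡ : ∀ t i → local X Y t 0F i ≡ (+ X 2F i ℤ.- + X 3F i) ℤ.+ (D P t · Y t 0F) i
    local₀-≡ t i = row (+ X 2F i) (+ X 3F i) ((D P t · Y t 0F) i)
      where
      row : ∀ u⁺ u⁻ z → (0ℤ ℤ.+ (0ℤ ℤ.+ (u⁺ ℤ.+ (ℤ.- u⁻ ℤ.+ (0ℤ ℤ.+ 0ℤ))))) ℤ.+ (z ℤ.+ 0ℤ) ≡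
                        (u⁺ ℤ.- u⁻) ℤ.+ z
      row = ℤ-Solver.solve-∀

    local₁-≡ : ∀ t i → local X Y t 1F i ≡ + X 0F i ℤ.- + Y t 1F i
    local₁-≡ t i = row (+ X 0F i) (+ Y t 1F i)
      where
      row : ∀ x w → (x ℤ.+ 0ℤ) ℤ.+ (0ℤ ℤ.+ (ℤ.- w ℤ.+ (0ℤ ℤ.+ (0ℤ ℤ.+ (0ℤ ℤ.+ 0ℤ))))) ≡ x ℤ.- w
      row = ℤ-Solver.solve-∀

    local₂-≡ : ∀ t i → local X Y t 2F i ≡ + X 1F i ℤ.- + Y t 2F i
    local₂-≡ t i = row (+ X 1F i) (+ Y t 2F i)
      where
      row : ∀ s w → (0ℤ ℤ.+ (s ℤ.+ 0ℤ)) ℤ.+ (0ℤ ℤ.+ (0ℤ ℤ.+ (ℤ.- w ℤ.+ (0ℤ ℤ.+ (0ℤ ℤ.+ 0ℤ))))) ≡ s ℤ.- w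
      row = ℤ-Solver.solve-∀

    local₃-≡ : ∀ t i → local X Y t 3F i ≡
               ((sourceMatrix P t B̲ · Y t 1F) i ℤ.+ (sourceMatrix P t C̲ · Y t 2F) i) ℤ.- + Y t 3F i
    local₃-≡ t i = row ((sourceMatrix P t B̲ · Y t 1F) i) ((sourceMatrix P t C̲ · Y t 2F) i) (+ Y t 3F i)
      where
      row : ∀ z w p → 0ℤ ℤ.+ (0ℤ ℤ.+ (z ℤ.+ (w ℤ.+ (ℤ.- p ℤ.+ (0ℤ ℤ.+ 0ℤ))))) ≡ (z ℤ.+ w) ℤ.- p
      row = ℤ-Solver.solve-∀

    local₄-≡ : ∀ t i → local X Y t 4F i ≡ (sourceMatrix P t A̲ · Y t 1F) i ℤ.- + Y t 4F i
    local₄-≡ t i = row ((sourceMatrix P t A̲ · Y t 1F) i) (+ Y t 4F i)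
      where
      row : ∀ z q → 0ℤ ℤ.+ (0ℤ ℤ.+ (z ℤ.+ (0ℤ ℤ.+ (0ℤ ℤ.+ (ℤ.- q ℤ.+ 0ℤ))))) ≡ z ℤ.- q
      row = ℤ-Solver.solve-∀

    System : Set
    System = (∀ a′ i → link X Y a′ i ≡ padded (a P) a′ i)
           × (∀ t a′ i → local X Y t a′ i ≡ padded (b P t) a′ i)

    solves⇒system : Solves X Y → System
    solves⇒system sol = links , locals
      where
      open Solves sol
      links : ∀ a′ i → link X Y a′ i ≡ padded (a P) a′ i
      links 0F i = trans (link₀-≡ i) (link₀ i)
      links 1F i = trans (link₁-≡ i) (ℤ.i≡j⇒i-j≡0 (link₁ i))
      links 2F i = trans (link₂-≡ i) (ℤ.i≡j⇒i-j≡0 (link₂ i))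
      links 3F i = trans (link₃-≡ i) (link₃ i)
      links 4F i = link₄-≡ i
      locals : ∀ t a′ i → local X Y t a′ i ≡ padded (b P t) a′ i
      locals t 0F i = trans (local₀-≡ t i) (local₀ t i)
      locals t 1F i = trans (local₁-≡ t i) (ℤ.i≡j⇒i-j≡0 (local₁ t i))
      locals t 2F i = trans (local₂-≡ t i) (ℤ.i≡j⇒i-j≡0 (local₂ t i))
      locals t 3F i = trans (local₃-≡ t i) (ℤ.i≡j⇒i-j≡0 (local₃ t i))
      locals t 4F i = trans (local₄-≡ t i) (ℤ.i≡j⇒i-j≡0 (local₄ t i))

    system⇒solves : System → Solves X Y
    system⇒solves (links , locals) = record
      { link₀  = λ i → trans (sym (link₀-≡ i)) (links 0F i)
      ; link₁  = λ i → ℤ.i-j≡0⇒i≡j _ _ (trans (sym (link₁-≡ i)) (links 1F i))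
      ; link₂  = λ i → ℤ.i-j≡0⇒i≡j _ _ (trans (sym (link₂-≡ i)) (links 2F i))
      ; link₃  = λ i → trans (sym (link₃-≡ i)) (links 3F i)
      ; local₀ = λ t i → trans (sym (local₀-≡ t i)) (locals t 0F i)
      ; local₁ = λ t i → ℤ.i-j≡0⇒i≡j _ _ (trans (sym (local₁-≡ t i)) (locals t 1F i))
      ; local₂ = λ t i → ℤ.i-j≡0⇒i≡j _ _ (trans (sym (local₂-≡ t i)) (locals t 2F i))
      ; local₃ = λ t i → ℤ.i-j≡0⇒i≡j _ _ (trans (sym (local₃-≡ t i)) (locals t 3F i))
      ; local₄ = λ t i → ℤ.i-j≡0⇒i≡j _ _ (trans (sym (local₄-≡ t i)) (locals t 4F i))
      }

  -- Needed because a flattened vector, cut into blocks again, agrees with the original only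
  -- pointwise.
  layoutRow-cong : ∀ {S} (M : S → Matrix k) (L : Layout S) a {V W : Vector (Vector ℕ k) 5} →
                   (∀ b j → V b j ≡ W b j) → ∀ i → layoutRow M L a V i ≡ layoutRow M L a W i
  layoutRow-cong M L a {V} {W} V≗W i = sum-cong-≗ {5} λ b → trans (sym (block-· M (entry b) (V b) i))
    (trans (·-congʳ (block M (entry b)) (V≗W b) i) (block-· M (entry b) (W b) i))
    where entry = lookup (lookup L a)

  system⇒feasible : ∀ X Y → System X Y → Feasible (reduced P)
  system⇒feasible X Y (links , locals) = flatten X , flatten ∘ Y ,
    ∀-combine {5} {k} (λ a′ i → trans
      (cong₂ _+ℤ_ (product noSource layoutB X a′ i)
                  (sum-cong-≗ {n} λ t → product noSource layoutC (Y t) a′ i))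
      (trans (links a′ i) (sym (flatten-combine (padded (a P)) a′ i)))) ,
    λ t → ∀-combine {5} {k} (λ a′ i → trans
      (cong₂ _+ℤ_ (product noSource layoutA X a′ i) (product (sourceMatrix P t) layoutD (Y t) a′ i))
      (trans (locals t a′ i) (sym (flatten-combine (padded (b P t)) a′ i))))
    where
    product : ∀ {S} (M : S → Matrix k) (L : Layout S) V a′ i →
              (blockMatrix (fill M L) · flatten V) (combine a′ i) ≡ layoutRow M L a′ V i
    product M L V a′ i = trans (fill-· M L (flatten V) a′ i)
                               (layoutRow-cong M L a′ (flatten-combine V) i)

  feasible⇒system : Feasible (reduced P) → ∃[ X ] ∃[ Y ] System X Y
  feasible⇒system (X , Y , links , locals) = (λ a′ i → X (combine a′ i)) , (λ t a′ i → Y t (combine a′ i)) ,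
    (λ a′ i → trans
      (sym (cong₂ _+ℤ_ (fill-· noSource layoutB X a′ i)
                       (sum-cong-≗ {n} λ t → fill-· noSource layoutC (Y t) a′ i)))
      (trans (links (combine a′ i)) (flatten-combine (padded (a P)) a′ i))) ,
    λ t a′ i → trans
      (sym (cong₂ _+ℤ_ (fill-· noSource layoutA X a′ i) (fill-· (sourceMatrix P t) layoutD (Y t) a′ i)))
      (trans (locals t (combine a′ i)) (flatten-combine (padded (b P t)) a′ i))

-- Equivalence of the two feasibility problems.

·-∑ : ∀ {n k} (M : Matrix k) (s : Vector ℕ k) (y : Vector (Vector ℕ k) n) →
      (∀ j → ∑[ t < n ] (+ y t j) ≡ + s j) → ∀ i → (M · s) i ≡ ∑[ t < n ] ((M · y t) i)
·-∑ {n} {k} M s y ∑y≡s i = begin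
  ∑[ j < k ] (M i j ℤ.* + s j)
    ≡⟨ sum-cong-≗ (λ j → cong (M i j ℤ.*_) (sym (∑y≡s j))) ⟩
  ∑[ j < k ] (M i j ℤ.* (∑[ t < n ] (+ y t j)))
    ≡⟨ sum-cong-≗ (λ j → *-distribˡ-sum (M i j) (λ (t : Fin n) → + y t j)) ⟩
  ∑[ j < k ] ∑[ t < n ] (M i j ℤ.* + y t j)
    ≡⟨ ∑-comm (λ j (t : Fin n) → M i j ℤ.* + y t j) ⟩
  ∑[ t < n ] ((M · y t) i) ∎
  where open ≡-Reasoning

-- The product taken in the natural numbers: thanks to the shift it is an admissible value for local
-- variables.
shiftedSign-· : ∀ {k} → ℕ → Matrix k → Vector ℕ k → Vector ℕ k
shiftedSign-· r M v i = ℕ-Sum.sum λ j → shiftedSign r (M i j) * v j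

shiftedSignMatrix-· : ∀ {k} r (M : Matrix k) v i → (shiftedSignMatrix r M · v) i ≡ + shiftedSign-· r M v i
shiftedSignMatrix-· r M v i = trans
  (sum-cong-≗ λ j → sym (ℤ.pos-* (shiftedSign r (M i j)) (v j)))
  (∑-pos (λ j → shiftedSign r (M i j) * v j))

positivePart negativePart : ℤ → ℕ
positivePart (+ m)    = m
positivePart -[1+ m ] = 0
negativePart (+ m)    = 0
negativePart -[1+ m ] = suc m

positivePart-negativePart : ∀ z → + positivePart z ℤ.- + negativePart z ≡ z
positivePart-negativePart (+ m)    = ℤ.+-identityʳ (+ m)
positivePart-negativePart -[1+ m ] = refl

module _ {n k : ℕ} (P : FourBlock n k) (bounded : ABCBoundedBy-n P) where

  open ≡-Reasoning

  ∑-A : ∀ x i → ∑[ t < n ] ((sourceMatrix P t A̲ · x) i ℤ.- total x) ≡ (A P · x) i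
  ∑-A = ∑-shiftedSignMatrix (A P) (λ i j → proj₁ (bounded i j))

  ∑-BC : ∀ x s i →
    ∑[ t < n ] (((sourceMatrix P t B̲ · x) i ℤ.+ (sourceMatrix P t C̲ · s) i) ℤ.- (total x ℤ.+ total s)) ≡
    (B P · x) i ℤ.+ (C P · s) i
  ∑-BC x s i = begin
    ∑[ t < n ] ((B̂x t ℤ.+ Ĉs t) ℤ.- (total x ℤ.+ total s))
      ≡⟨ sum-cong-≗ {n} (λ t → interchange (B̂x t) (Ĉs t) (total x) (total s)) ⟩
    ∑[ t < n ] ((B̂x t ℤ.- total x) ℤ.+ (Ĉs t ℤ.- total s))
      ≡⟨ ∑-distrib-+ (λ t → B̂x t ℤ.- total x) (λ t → Ĉs t ℤ.- total s) ⟩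
    ∑[ t < n ] (B̂x t ℤ.- total x) ℤ.+ ∑[ t < n ] (Ĉs t ℤ.- total s)
      ≡⟨ cong₂ _+ℤ_ (∑-shiftedSignMatrix (B P) (λ i j → proj₁ (proj₂ (bounded i j))) x i)
                    (∑-shiftedSignMatrix (C P) (λ i j → proj₂ (proj₂ (bounded i j))) s i) ⟩
    (B P · x) i ℤ.+ (C P · s) i ∎
    where
    B̂x Ĉs : Fin n → ℤ
    B̂x t = (sourceMatrix P t B̲ · x) i
    Ĉs t = (sourceMatrix P t C̲ · s) i
    interchange : ∀ u v w z → (u ℤ.+ v) ℤ.- (w ℤ.+ z) ≡ (u ℤ.- w) ℤ.+ (v ℤ.- z)
    interchange = ℤ-Solver.solve-∀

  feasible⇒solves : Feasible P → ∃[ X ] ∃[ Y ] Solves P X Y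
  feasible⇒solves (x , y , linkEq , localEq) = X , Y , record
    { link₀  = λ i → begin
        ∑[ t < n ] (+ p t i ℤ.- (total x ℤ.+ total s))
          ≡⟨ sum-cong-≗ {n} (λ t → cong (ℤ._- (total x ℤ.+ total s)) (sym (p-eq t i))) ⟩
        _ ≡⟨ ∑-BC x s i ⟩
        (B P · x) i ℤ.+ (C P · s) i
          ≡⟨ cong ((B P · x) i +ℤ_) (·-∑ (C P) s y ∑y≡s i) ⟩
        (B P · x) i ℤ.+ ∑[ t < n ] ((C P · y t) i)
          ≡⟨ linkEq i ⟩
        a P i ∎
    ; link₁  = λ i → begin
        ∑[ t < n ] (+ q t i ℤ.- total x)
          ≡⟨ sum-cong-≗ {n} (λ t → cong (ℤ._- total x) (sym (q-eq t i))) ⟩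
        _ ≡⟨ ∑-A x i ⟩
        (A P · x) i
          ≡⟨ positivePart-negativePart ((A P · x) i) ⟨
        + X 2F i ℤ.- + X 3F i ∎
    ; link₂  = ∑y≡s
    ; link₃  = λ i → refl
    ; local₀ = λ t i → trans
        (cong (_+ℤ (D P t · y t) i) (positivePart-negativePart ((A P · x) i))) (localEq t i)
    ; local₁ = λ t i → refl
    ; local₂ = λ t i → refl
    ; local₃ = p-eq
    ; local₄ = q-eq
    }
    where
    s : Vector ℕ k
    s i = ℕ-Sum.sum λ t → y t i
    ∑y≡s : ∀ i → ∑[ t < n ] (+ y t i) ≡ + s i
    ∑y≡s i = ∑-pos λ t → y t i
    p q : Vector (Vector ℕ k) n
    p t i = shiftedSign-· (n ∸ toℕ t) (B P) x i + shiftedSign-· (n ∸ toℕ t) (C P) s i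
    q t   = shiftedSign-· (n ∸ toℕ t) (A P) x
    p-eq : ∀ t i → (sourceMatrix P t B̲ · x) i ℤ.+ (sourceMatrix P t C̲ · s) i ≡ + p t i
    p-eq t i = cong₂ _+ℤ_ (shiftedSignMatrix-· (n ∸ toℕ t) (B P) x i)
                          (shiftedSignMatrix-· (n ∸ toℕ t) (C P) s i)
    q-eq : ∀ t i → (sourceMatrix P t A̲ · x) i ≡ + q t i
    q-eq t i = shiftedSignMatrix-· (n ∸ toℕ t) (A P) x i
    X : Vector (Vector ℕ k) 5
    -- A x may be negative, so u⁺ and u⁻ are its positive and negative parts; the dummy is 0.
    X = lookup (x ∷ s ∷ positivePart ∘ (A P · x) ∷ negativePart ∘ (A P · x) ∷ (λ _ → 0) ∷ [])
    Y : Vector (Vector (Vector ℕ k) 5) n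
    Y t = lookup (y t ∷ x ∷ s ∷ p t ∷ q t ∷ [])

  -- `local₁` and `local₂` force the copies in every block to equal x and s, so that the local
  -- results sum to B x + C s and A x. Of u⁺ and u⁻ only the difference matters.
  solves⇒feasible : ∀ X Y → Solves P X Y → Feasible P
  solves⇒feasible X Y sol = x , y , linkEq , localEq
    where
    open Solves sol
    x s : Vector ℕ k
    x = X 0F
    s = X 1F
    y : Vector (Vector ℕ k) n
    y t = Y t 0F
    x̲≡x : ∀ t j → Y t 1F j ≡ x j
    x̲≡x t j = ℤ.+-injective (sym (local₁ t j))
    s̲≡s : ∀ t j → Y t 2F j ≡ s j
    s̲≡s t j = ℤ.+-injective (sym (local₂ t j))
    total-cong : ∀ {v w : Vector ℕ k} → (∀ j → v j ≡ w j) → total v ≡ total w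
    total-cong v≗w = sum-cong-≗ λ j → cong +_ (v≗w j)
    linkEq : ∀ i → (B P · x) i ℤ.+ ∑[ t < n ] ((C P · y t) i) ≡ a P i
    linkEq i = begin
      (B P · x) i ℤ.+ ∑[ t < n ] ((C P · y t) i)
        ≡⟨ cong ((B P · x) i +ℤ_) (·-∑ (C P) s y link₂ i) ⟨
      (B P · x) i ℤ.+ (C P · s) i
        ≡⟨ ∑-BC x s i ⟨
      ∑[ t < n ] (((sourceMatrix P t B̲ · x) i ℤ.+ (sourceMatrix P t C̲ · s) i) ℤ.- (total x ℤ.+ total s))
        ≡⟨ sum-cong-≗ {n} (λ t → cong₂ ℤ._-_
             (trans (sym (cong₂ _+ℤ_ (·-congʳ (sourceMatrix P t B̲) (x̲≡x t) i)
                                     (·-congʳ (sourceMatrix P t C̲) (s̲≡s t) i)))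
                    (local₃ t i))
             (sym (cong₂ _+ℤ_ (total-cong (x̲≡x t)) (total-cong (s̲≡s t))))) ⟩
      ∑[ t < n ] (+ Y t 3F i ℤ.- (total (Y t 1F) ℤ.+ total (Y t 2F)))
        ≡⟨ link₀ i ⟩
      a P i ∎
    Ax : ∀ i → (A P · x) i ≡ + X 2F i ℤ.- + X 3F i
    Ax i = begin
      (A P · x) i
        ≡⟨ ∑-A x i ⟨
      ∑[ t < n ] ((sourceMatrix P t A̲ · x) i ℤ.- total x)
        ≡⟨ sum-cong-≗ {n} (λ t → cong₂ ℤ._-_
             (trans (sym (·-congʳ (sourceMatrix P t A̲) (x̲≡x t) i)) (local₄ t i))
             (sym (total-cong (x̲≡x t)))) ⟩
      ∑[ t < n ] (+ Y t 4F i ℤ.- total (Y t 1F))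
        ≡⟨ link₁ i ⟩
      + X 2F i ℤ.- + X 3F i ∎
    localEq : ∀ t i → (A P · x) i ℤ.+ (D P t · y t) i ≡ b P t i
    localEq t i = trans (cong (_+ℤ (D P t · y t) i) (Ax i)) (local₀ t i)

  reduced-feasible : Feasible (reduced P) ⇔ Feasible P
  reduced-feasible = mk⇔
    (λ feasible → let (X , Y , system) = feasible⇒system P feasible in
      solves⇒feasible X Y (system⇒solves P X Y system))
    (λ feasible → let (X , Y , solves) = feasible⇒solves feasible in
      system⇒feasible P X Y (solves⇒system P X Y solves))

-- The largest coefficient of the reduced program.

maximum-lub : ∀ {m b} {f : Vector ℕ m} → (∀ i → f i ≤ b) → maximum f ≤ b
maximum-lub {zero}  f≤b = z≤n
maximum-lub {suc m} f≤b = ⊔-lub (f≤b zero) (maximum-lub (f≤b ∘ suc))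

≤-maximum : ∀ {m} (f : Vector ℕ m) i → f i ≤ maximum f
≤-maximum f zero    = m≤m⊔n (f zero) _
≤-maximum f (suc i) = ≤-trans (≤-maximum (f ∘ suc) i) (m≤n⊔m (f zero) _)

‖‖∞-lub : ∀ {k b} {M : Matrix k} → (∀ i j → ∣ M i j ∣ ≤ b) → ‖ M ‖∞ ≤ b
‖‖∞-lub M≤b = maximum-lub λ i → maximum-lub (M≤b i)

≤-‖‖∞ : ∀ {k} (M : Matrix k) i j → ∣ M i j ∣ ≤ ‖ M ‖∞
≤-‖‖∞ M i j = ≤-trans (≤-maximum (λ j → ∣ M i j ∣) j) (≤-maximum (λ i → maximum λ j → ∣ M i j ∣) i)

≤-Δ : ∀ {n k} (P : FourBlock n k) s t i j → ∣ constraintMatrix P s t i j ∣ ≤ Δ P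
≤-Δ P s t i j = ≤-trans (≤-‖‖∞ (constraintMatrix P s t) i j)
  (≤-trans (≤-maximum (λ t → ‖ constraintMatrix P s t ‖∞) t)
           (≤-maximum (λ s → maximum λ t → ‖ constraintMatrix P s t ‖∞) s))

Δ-lub : ∀ {n k b} (P : FourBlock n k) →
        (∀ i j → ∣ A P i j ∣ ≤ b) → (∀ i j → ∣ B P i j ∣ ≤ b) → (∀ i j → ∣ C P i j ∣ ≤ b) →
        (∀ t i j → ∣ D P t i j ∣ ≤ b) → Δ P ≤ b
Δ-lub {b = b} P A≤b B≤b C≤b D≤b = maximum-lub λ s → maximum-lub λ t → ‖‖∞-lub {M = constraintMatrix P s t} (entry s t)
  where
  entry : ∀ s t i j → ∣ constraintMatrix P s t i j ∣ ≤ b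
  entry zero    zero    i j = B≤b i j
  entry zero    (suc t) i j = C≤b i j
  entry (suc s) zero    i j = A≤b i j
  entry (suc s) (suc t) i j with s Fin.≟ t
  ... | yes _ = D≤b s i j
  ... | no  _ = z≤n

D≤Δ : ∀ {n k} (P : FourBlock n k) t i j → ∣ D P t i j ∣ ≤ Δ P
D≤Δ P t i j = subst (λ M → ∣ M i j ∣ ≤ Δ P) diagonal (≤-Δ P (suc t) (suc t) i j)
  where
  diagonal : constraintMatrix P (suc t) (suc t) ≡ D P t
  diagonal with t Fin.≟ t
  ... | yes _   = refl
  ... | no  t≢t = contradiction refl t≢t

D≤max‖D‖ : ∀ {n k} (P : FourBlock n k) t i j → ∣ D P t i j ∣ ≤ max‖D‖ P
D≤max‖D‖ P t i j = ≤-trans (≤-‖‖∞ (D P t) i j) (≤-maximum (λ t → ‖ D P t ‖∞) t)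

blockMatrix-combine : ∀ {p k} (M : Vector (Vector (Matrix k) p) p) a i b j →
                      blockMatrix M (combine a i) (combine b j) ≡ M a b i j
blockMatrix-combine {p} {k} M a i b j = trans
  (cong (λ row → row (combine b j)) (flatten-combine (λ a i → flatten λ b → M a b i) a i))
  (flatten-combine (λ b → M a b i) b j)

shiftedSign≤2 : ∀ r z → shiftedSign r z ≤ 2
shiftedSign≤2 r z with r ≤? ∣ z ∣
shiftedSign≤2 r (+ _)    | yes _ = ≤-refl
shiftedSign≤2 r -[1+ _ ] | yes _ = z≤n
shiftedSign≤2 r z        | no  _ = s≤s z≤n

scalarMatrix-≤ : ∀ {k b} c d → ∣ c ∣ ≤ b → ∣ d ∣ ≤ b → ∀ (i j : Fin k) → ∣ scalarMatrix c d i j ∣ ≤ b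
scalarMatrix-≤ c d c≤b d≤b i j with i Fin.≟ j
... | yes _ = c≤b
... | no  _ = d≤b

module _ {k b : ℕ} (2≤b : 2 ≤ b) where

  1≤b : 1 ≤ b
  1≤b = ≤-trans (n≤1+n 1) 2≤b

  block-≤ : ∀ {S} (M : S → Matrix k) → (∀ s i j → ∣ M s i j ∣ ≤ b) → ∀ X i j → ∣ block M X i j ∣ ≤ b
  block-≤ M M≤b O          = scalarMatrix-≤ 0ℤ 0ℤ z≤n z≤n
  block-≤ M M≤b I          = scalarMatrix-≤ 1ℤ 0ℤ 1≤b z≤n
  block-≤ M M≤b N          = scalarMatrix-≤ -1ℤ 0ℤ 1≤b z≤n
  block-≤ M M≤b T          = scalarMatrix-≤ (+ 2) 0ℤ 2≤b z≤n
  block-≤ M M≤b J          = scalarMatrix-≤ -1ℤ -1ℤ 1≤b 1≤b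
  block-≤ M M≤b (source s) = M≤b s

  fill-≤ : ∀ {S} (M : S → Matrix k) (L : Layout S) → (∀ s i j → ∣ M s i j ∣ ≤ b) →
           ∀ i j → ∣ blockMatrix (fill M L) i j ∣ ≤ b
  fill-≤ M L M≤b = ∀-combine {5} {k} λ a i → ∀-combine {5} {k} λ b′ j →
    ≤-trans (≤-reflexive (cong ∣_∣ (blockMatrix-combine (fill M L) a i b′ j)))
            (block-≤ M M≤b (lookup (lookup L a) b′) i j)

-- An equation rather than an upper bound, since f is an arbitrary computable function and need not
-- be monotone.
Δ-reduced-suc : ∀ {n k} (P : FourBlock n (suc k)) → Δ (reduced P) ≡ 2 ⊔ max‖D‖ P
Δ-reduced-suc {n} {k} P = ≤-antisym
  (Δ-lub (reduced P) (fill-≤ {suc k} 2≤ noSource layoutA (λ ())) (fill-≤ {suc k} 2≤ noSource layoutB (λ ()))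
         (fill-≤ {suc k} 2≤ noSource layoutC (λ ())) (λ t → fill-≤ {suc k} 2≤ (sourceMatrix P t) layoutD (source-≤ t)))
  -- The value 2 is attained in the block `T` of `layoutB`, which has an entry because the dimension
  -- is positive; each `D` occurs as a block of the new one.
  (⊔-lub (subst (_≤ Δ (reduced P))
            (cong ∣_∣ (blockMatrix-combine {5} {suc k} (fill noSource layoutB) 3F 0F 4F 0F))
            (≤-Δ (reduced P) 0F 0F (combine {5} {suc k} 3F 0F) (combine {5} {suc k} 4F 0F)))
         (maximum-lub λ t → ‖‖∞-lub {M = D P t} λ i j → subst (_≤ Δ (reduced P))
            (cong ∣_∣ (blockMatrix-combine {5} {suc k} (fill (sourceMatrix P t) layoutD) 0F i 0F j))
            (D≤Δ (reduced P) t (combine {5} {suc k} 0F i) (combine {5} {suc k} 0F j))))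
  where
  2≤ : 2 ≤ 2 ⊔ max‖D‖ P
  2≤ = m≤m⊔n 2 (max‖D‖ P)
  source-≤ : ∀ t s i j → ∣ sourceMatrix P t s i j ∣ ≤ 2 ⊔ max‖D‖ P
  source-≤ t A̲ i j = ≤-trans (shiftedSign≤2 (n ∸ toℕ t) (A P i j)) 2≤
  source-≤ t B̲ i j = ≤-trans (shiftedSign≤2 (n ∸ toℕ t) (B P i j)) 2≤
  source-≤ t C̲ i j = ≤-trans (shiftedSign≤2 (n ∸ toℕ t) (C P i j)) 2≤
  source-≤ t D̲ i j = ≤-trans (D≤max‖D‖ P t i j) (m≤n⊔m 2 (max‖D‖ P))

Δ-empty : ∀ {n} (P : FourBlock n 0) → Δ P ≡ 0
Δ-empty P = n≤0⇒n≡0 (Δ-lub P (λ ()) (λ ()) (λ ()) (λ t ()))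

-- Encodings

encodeVector-cong : ∀ {U V : Set} {m} {enc : U → Tree} {enc′ : V → Tree} {v : Vector U m} {w : Vector V m} →
                    (∀ i → enc (v i) ≡ enc′ (w i)) → encodeVector enc v ≡ encodeVector enc′ w
encodeVector-cong {m = zero}  eq = refl
encodeVector-cong {m = suc m} eq = cong₂ cons (eq zero) (encodeVector-cong (eq ∘ suc))

encodeVector-↑ : ∀ {U : Set} (enc : U → Tree) m {n} (v : Vector U (m + n)) →
                 encodeVector enc v ≡ encodeVector enc (v ∘ (_↑ˡ n)) ⊕ encodeVector enc (v ∘ (m ↑ʳ_))
encodeVector-↑ enc zero    v = refl
encodeVector-↑ enc (suc m) v = cong (cons _) (encodeVector-↑ enc m (v ∘ suc))

-- Peeling off the first block matches the recursions that assemble block vectors and block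
-- matrices.
encodeVector-flatten : ∀ {U : Set} (enc : U → Tree) {p k} (v : Vector (Vector U k) (suc p)) →
  encodeVector enc (flatten v) ≡ encodeVector enc (v zero) ⊕ encodeVector enc (flatten (v ∘ suc))
encodeVector-flatten enc {p} {k} v = trans (encodeVector-↑ enc k (flatten v)) (cong₂ _⊕_
  (encodeVector-cong {enc = enc} λ i → cong enc (flatten-combine v zero i))
  (encodeVector-cong {enc = enc} λ i → cong enc (tail i)))
  where
  tail : ∀ i → flatten v (k ↑ʳ i) ≡ flatten (v ∘ suc) i
  tail i rewrite Fin.splitAt-↑ʳ k (p * k) i = refl

suffix : ∀ {U : Set} (enc : U → Tree) {m} → Vector U m → Fin m → Tree
suffix enc v zero    = encodeVector enc v
suffix enc v (suc i) = suffix enc (v ∘ suc) i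

hd-suffix : ∀ {U : Set} (enc : U → Tree) {m} (v : Vector U m) i → hd (suffix enc v i) ≡ enc (v i)
hd-suffix enc v zero    = refl
hd-suffix enc v (suc i) = hd-suffix enc (v ∘ suc) i

length-encodeVector : ∀ {U : Set} (enc : U → Tree) {m} (v : Vector U m) → length (encodeVector enc v) ≡ m
length-encodeVector enc {zero}  v = refl
length-encodeVector enc {suc m} v = cong suc (length-encodeVector enc (v ∘ suc))

-- The length of a suffix encodes its position. It serves both to recognise diagonal entries and as
-- the position r at which signs are taken.
length-suffix : ∀ {U : Set} (enc : U → Tree) {m} (v : Vector U m) i → length (suffix enc v i) ≡ m ∸ toℕ i
length-suffix enc v zero    = length-encodeVector enc v
length-suffix enc v (suc i) = length-suffix enc (v ∘ suc) i

mapSuffixes-encodeVector : ∀ {U V : Set} {m} {enc : U → Tree} {enc′ : V → Tree} g (v : Vector U m) {w : Vector V m} →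
  (∀ i → g (suffix enc v i) ≡ enc′ (w i)) → mapSuffixes g (encodeVector enc v) ≡ encodeVector enc′ w
mapSuffixes-encodeVector {m = zero}  g v eq = refl
mapSuffixes-encodeVector {m = suc m} g v eq = cong₂ cons (eq zero) (mapSuffixes-encodeVector g (v ∘ suc) (eq ∘ suc))

⟦mapᴾ⟧-encodeVector : ∀ {U V : Set} {m} {enc : U → Tree} {enc′ : V → Tree} F env (v : Vector U m) {w : Vector V m} →
  (∀ i → ⟦ F ⟧ (cons (enc (v i)) env) ≡ enc′ (w i)) →
  ⟦ mapᴾ F ⟧ (cons (encodeVector enc v) env) ≡ encodeVector enc′ w
⟦mapᴾ⟧-encodeVector {enc = enc} {enc′} F env v {w} eq = trans
  (⟦mapSuffixesᴾ⟧ (F ∘ᴾ ⟨ hdᴾ ∘ᴾ hdᴾ , tlᴾ ⟩ᴾ) (encodeVector enc v) env)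
  (mapSuffixes-encodeVector {enc = enc} {enc′ = enc′} _ v
    λ i → trans (cong (λ u → ⟦ F ⟧ (cons u env)) (hd-suffix enc v i)) (eq i))

zipAppend-encodeVector : ∀ {U V W : Set} {m} {enc : U → Tree} {enc′ : V → Tree} {enc″ : W → Tree}
  (M : Vector U m) (M′ : Vector V m) {R : Vector W m} → (∀ i → enc (M i) ⊕ enc′ (M′ i) ≡ enc″ (R i)) →
  zipAppendOnto (encodeVector enc M) (encodeVector enc′ M′) nil ≡ encodeVector enc″ R
zipAppend-encodeVector {m = zero}  M M′ eq = refl
zipAppend-encodeVector {m = suc m} M M′ eq =
  cong₂ cons (eq zero) (zipAppend-encodeVector (M ∘ suc) (M′ ∘ suc) (eq ∘ suc))

-- Block matrices as trees

-- The input is cons s l.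
sameLengthᴾ : PolyTime → PolyTime → PolyTime
sameLengthᴾ F G = ifᴾ dropᴾ then G else (ifᴾ dropᴾ ∘ᴾ ⟨ tlᴾ , hdᴾ ⟩ᴾ then G else F)

⟦sameLengthᴾ⟧-≡ : ∀ F G s l → length l ≡ length s → ⟦ sameLengthᴾ F G ⟧ (cons s l) ≡ ⟦ F ⟧ (cons s l)
⟦sameLengthᴾ⟧-≡ F G s l eq = trans
  (branch-zero (⟦ dropᴾ ⟧ (cons s l)) _ _
    (trans (length-dropᴾ s l) (m≤n⇒m∸n≡0 (≤-reflexive eq))))
  (branch-zero (⟦ dropᴾ ⟧ (cons l s)) _ _
    (trans (length-dropᴾ l s) (m≤n⇒m∸n≡0 (≤-reflexive (sym eq)))))

⟦sameLengthᴾ⟧-≢ : ∀ F G s l → length l ≢ length s → ⟦ sameLengthᴾ F G ⟧ (cons s l) ≡ ⟦ G ⟧ (cons s l)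
⟦sameLengthᴾ⟧-≢ F G s l neq with length l ≤? length s
... | no l≰s = branch-nonzero (⟦ dropᴾ ⟧ (cons s l)) _ _
  λ eq → l≰s (m∸n≡0⇒m≤n (trans (sym (length-dropᴾ s l)) eq))
... | yes l≤s = trans
  (branch-zero (⟦ dropᴾ ⟧ (cons s l)) _ _ (trans (length-dropᴾ s l) (m≤n⇒m∸n≡0 l≤s)))
  (branch-nonzero (⟦ dropᴾ ⟧ (cons l s)) _ _
    λ eq → neq (≤-antisym l≤s (m∸n≡0⇒m≤n (trans (sym (length-dropᴾ l s)) eq))))

-- K computes a list whose length is the dimension.
module Assemble (K : PolyTime) where

  abstract

    -- Rows and columns are indexed by suffixes of the same list, so an entry is diagonal exactly
    -- when the two suffixes have equal length.
    scalarRowᴾ scalarᴾ : ℤ → ℤ → PolyTime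
    scalarRowᴾ c d = mapSuffixesᴾ (sameLengthᴾ (constᴾ (encodeℤ c)) (constᴾ (encodeℤ d))) ∘ᴾ ⟨ tlᴾ , hdᴾ ⟩ᴾ
    scalarᴾ    c d = mapSuffixesᴾ (scalarRowᴾ c d) ∘ᴾ ⟨ K , K ⟩ᴾ

    zerosᴾ : PolyTime
    zerosᴾ = mapᴾ (constᴾ (encodeℤ 0ℤ)) ∘ᴾ ⟨ K , nilᴾ ⟩ᴾ

    besideᴾ : ∀ {p} → Vec PolyTime p → PolyTime
    -- A matrix without columns still has k rows, all empty.
    besideᴾ []       = mapᴾ nilᴾ ∘ᴾ ⟨ K , nilᴾ ⟩ᴾ
    besideᴾ (F ∷ Fs) = zipAppendᴾ ∘ᴾ ⟨ F , besideᴾ Fs ⟩ᴾ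

    aboveᴾ : ∀ {p} → Vec PolyTime p → PolyTime
    aboveᴾ []       = nilᴾ
    aboveᴾ (F ∷ Fs) = appendᴾ ∘ᴾ ⟨ F , aboveᴾ Fs ⟩ᴾ

    blockᴾ : ∀ {S} → (S → PolyTime) → Block S → PolyTime
    blockᴾ M O          = scalarᴾ 0ℤ 0ℤ
    blockᴾ M I          = scalarᴾ 1ℤ 0ℤ
    blockᴾ M N          = scalarᴾ -1ℤ 0ℤ
    blockᴾ M T          = scalarᴾ (+ 2) 0ℤ
    blockᴾ M J          = scalarᴾ -1ℤ -1ℤ
    blockᴾ M (source s) = M s

    layoutᴾ : ∀ {S} → (S → PolyTime) → Layout S → PolyTime
    layoutᴾ M L = aboveᴾ (Vec.map (λ r → besideᴾ (Vec.map (blockᴾ M) r)) L)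

    paddedᴾ : PolyTime → PolyTime
    paddedᴾ F = aboveᴾ (F ∷ zerosᴾ ∷ zerosᴾ ∷ zerosᴾ ∷ zerosᴾ ∷ [])

    ⟦aboveᴾ⟧ : ∀ {U : Set} {enc : U → Tree} {p k} (Fs : Vec PolyTime p) v (V : Vector (Vector U k) p) →
      (∀ a → ⟦ lookup Fs a ⟧ v ≡ encodeVector enc (V a)) → ⟦ aboveᴾ Fs ⟧ v ≡ encodeVector enc (flatten V)
    ⟦aboveᴾ⟧             []       v V eq = refl
    ⟦aboveᴾ⟧ {enc = enc} (F ∷ Fs) v V eq = trans (⟦appendᴾ⟧ (⟦ F ⟧ v) (⟦ aboveᴾ Fs ⟧ v))
      (trans (cong₂ _⊕_ (eq zero) (⟦aboveᴾ⟧ Fs v (V ∘ suc) (eq ∘ suc)))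
             (sym (encodeVector-flatten enc V)))

  module _ {k : ℕ} {U : Set} {enc : U → Tree} {w : Vector U k} {v : Tree} (⟦K⟧ : ⟦ K ⟧ v ≡ encodeVector enc w) where

    abstract

      ⟦scalarᴾ⟧ : ∀ c d → ⟦ scalarᴾ c d ⟧ v ≡ encodeMatrix {k} (scalarMatrix c d)
      ⟦scalarᴾ⟧ c d = trans
        (cong (λ l → ⟦ mapSuffixesᴾ (scalarRowᴾ c d) ⟧ (cons l l)) ⟦K⟧) (trans
        (⟦mapSuffixesᴾ⟧ (scalarRowᴾ c d) (encodeVector enc w) (encodeVector enc w))
        (mapSuffixes-encodeVector {enc = enc} {enc′ = encodeVector encodeℤ} _ w λ i → trans
          (⟦mapSuffixesᴾ⟧ entryᴾ (encodeVector enc w) (suffix enc w i))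
          (mapSuffixes-encodeVector {enc = enc} {enc′ = encodeℤ} _ w λ j → entry i j)))
        where
        entryᴾ : PolyTime
        entryᴾ = sameLengthᴾ (constᴾ (encodeℤ c)) (constᴾ (encodeℤ d))
        -- Truncated subtraction from k is injective on indices because they lie below k.
        lengths : ∀ i j → length (suffix enc w i) ≡ length (suffix enc w j) → i ≡ j
        lengths i j eq = Fin.toℕ-injective (∸-cancelˡ-≡ (<⇒≤ (Fin.toℕ<n i)) (<⇒≤ (Fin.toℕ<n j))
          (trans (sym (length-suffix enc w i)) (trans eq (length-suffix enc w j))))
        entry : ∀ i j → ⟦ entryᴾ ⟧ (cons (suffix enc w j) (suffix enc w i)) ≡ encodeℤ (scalarMatrix c d i j)
        entry i j with i Fin.≟ j
        ... | yes refl = trans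
          (⟦sameLengthᴾ⟧-≡ (constᴾ (encodeℤ c)) (constᴾ (encodeℤ d)) (suffix enc w j) (suffix enc w i) refl)
          (⟦constᴾ⟧ (encodeℤ c) _)
        ... | no  i≢j  = trans
          (⟦sameLengthᴾ⟧-≢ (constᴾ (encodeℤ c)) (constᴾ (encodeℤ d)) (suffix enc w j) (suffix enc w i)
            (i≢j ∘ lengths i j))
          (⟦constᴾ⟧ (encodeℤ d) _)

      ⟦zerosᴾ⟧ : ⟦ zerosᴾ ⟧ v ≡ encodeVector {m = k} encodeℤ (λ _ → 0ℤ)
      ⟦zerosᴾ⟧ = trans
        (cong (λ l → ⟦ mapᴾ (constᴾ (encodeℤ 0ℤ)) ⟧ (cons l nil)) ⟦K⟧)
        (⟦mapᴾ⟧-encodeVector {enc = enc} (constᴾ (encodeℤ 0ℤ)) nil w λ i → refl)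

      ⟦besideᴾ⟧ : ∀ {p} (Fs : Vec PolyTime p) (M : Vector (Matrix k) p) →
        (∀ b → ⟦ lookup Fs b ⟧ v ≡ encodeMatrix (M b)) →
        ⟦ besideᴾ Fs ⟧ v ≡ encodeVector (encodeVector encodeℤ) (λ i → flatten λ b → M b i)
      ⟦besideᴾ⟧ []       M eq = trans
        (cong (λ l → ⟦ mapᴾ nilᴾ ⟧ (cons l nil)) ⟦K⟧)
        (⟦mapᴾ⟧-encodeVector {enc = enc} nilᴾ nil w λ i → refl)
      ⟦besideᴾ⟧ (F ∷ Fs) M eq = trans (⟦zipAppendᴾ⟧ (⟦ F ⟧ v) (⟦ besideᴾ Fs ⟧ v)) (trans
        (cong₂ (λ l r → zipAppendOnto l r nil) (eq zero) (⟦besideᴾ⟧ Fs (M ∘ suc) (eq ∘ suc)))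
        (zipAppend-encodeVector (M zero) (λ i → flatten λ b → M (suc b) i)
          λ i → sym (encodeVector-flatten encodeℤ (λ b → M b i))))

      ⟦blockᴾ⟧ : ∀ {S} (F : S → PolyTime) (M : S → Matrix k) → (∀ s → ⟦ F s ⟧ v ≡ encodeMatrix (M s)) →
                 ∀ X → ⟦ blockᴾ F X ⟧ v ≡ encodeMatrix (block M X)
      ⟦blockᴾ⟧ F M eq O          = ⟦scalarᴾ⟧ 0ℤ 0ℤ
      ⟦blockᴾ⟧ F M eq I          = ⟦scalarᴾ⟧ 1ℤ 0ℤ
      ⟦blockᴾ⟧ F M eq N          = ⟦scalarᴾ⟧ -1ℤ 0ℤ
      ⟦blockᴾ⟧ F M eq T          = ⟦scalarᴾ⟧ (+ 2) 0ℤ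
      ⟦blockᴾ⟧ F M eq J          = ⟦scalarᴾ⟧ -1ℤ -1ℤ
      ⟦blockᴾ⟧ F M eq (source s) = eq s

      ⟦layoutᴾ⟧ : ∀ {S} (F : S → PolyTime) (M : S → Matrix k) (L : Layout S) →
                  (∀ s → ⟦ F s ⟧ v ≡ encodeMatrix (M s)) →
                  ⟦ layoutᴾ F L ⟧ v ≡ encodeMatrix (blockMatrix (fill M L))
      ⟦layoutᴾ⟧ F M L eq = ⟦aboveᴾ⟧ (Vec.map (λ r → besideᴾ (Vec.map (blockᴾ F) r)) L) v (λ a i → flatten λ b → fill M L a b i) λ a → trans
        (cong (λ G → ⟦ G ⟧ v) (lookup-map a (λ r → besideᴾ (Vec.map (blockᴾ F) r)) L))
        (⟦besideᴾ⟧ (Vec.map (blockᴾ F) (lookup L a)) (fill M L a) λ b → trans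
          (cong (λ G → ⟦ G ⟧ v) (lookup-map b (blockᴾ F) (lookup L a)))
          (⟦blockᴾ⟧ F M eq (lookup (lookup L a) b)))

      ⟦paddedᴾ⟧ : ∀ F (u : Vector ℤ k) → ⟦ F ⟧ v ≡ encodeVector encodeℤ u →
                  ⟦ paddedᴾ F ⟧ v ≡ encodeVector encodeℤ (flatten (padded u))
      ⟦paddedᴾ⟧ F u eq = ⟦aboveᴾ⟧ (F ∷ zerosᴾ ∷ zerosᴾ ∷ zerosᴾ ∷ zerosᴾ ∷ []) v (padded u)
        λ { 0F → eq ; 1F → ⟦zerosᴾ⟧ ; 2F → ⟦zerosᴾ⟧ ; 3F → ⟦zerosᴾ⟧ ; 4F → ⟦zerosᴾ⟧ }

-- The reduction as a polynomial-time function.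

noSourceᴾ : ⊥ → PolyTime
noSourceᴾ ()

-- The input is cons l v with v the encoded program and l a suffix of its list of local blocks.
sourceᴾ : Source → PolyTime
sourceᴾ A̲ = mapᴾ (mapᴾ shiftedSignᴾ) ∘ᴾ ⟨ hdᴾ ∘ᴾ tlᴾ , hdᴾ ⟩ᴾ
sourceᴾ B̲ = mapᴾ (mapᴾ shiftedSignᴾ) ∘ᴾ ⟨ hdᴾ ∘ᴾ tlᴾ ∘ᴾ tlᴾ , hdᴾ ⟩ᴾ
sourceᴾ C̲ = mapᴾ (mapᴾ shiftedSignᴾ) ∘ᴾ ⟨ hdᴾ ∘ᴾ tlᴾ ∘ᴾ tlᴾ ∘ᴾ tlᴾ , hdᴾ ⟩ᴾ
sourceᴾ D̲ = hdᴾ ∘ᴾ hdᴾ ∘ᴾ hdᴾ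

localᴾ : PolyTime
localᴾ = ⟨ layoutᴾ sourceᴾ layoutD , paddedᴾ (tlᴾ ∘ᴾ hdᴾ ∘ᴾ hdᴾ) ⟩ᴾ
  -- The list of rows of `A` supplies the dimension.
  where open Assemble (hdᴾ ∘ᴾ tlᴾ)

abstract

  reducedᴾ : PolyTime
  reducedᴾ =
    ⟨ layoutᴾ noSourceᴾ layoutA , ⟨ layoutᴾ noSourceᴾ layoutB , ⟨ layoutᴾ noSourceᴾ layoutC ,
    ⟨ paddedᴾ (hdᴾ ∘ᴾ tlᴾ ∘ᴾ tlᴾ ∘ᴾ tlᴾ)
    , mapSuffixesᴾ localᴾ ∘ᴾ ⟨ tlᴾ ∘ᴾ tlᴾ ∘ᴾ tlᴾ ∘ᴾ tlᴾ , idᴾ ⟩ᴾ ⟩ᴾ ⟩ᴾ ⟩ᴾ ⟩ᴾ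
    where open Assemble hdᴾ

-- The environment of both nested maps is the suffix itself, whose length is the position compared
-- with each entry.
⟦mapᴾ-shiftedSignᴾ⟧ : ∀ {k} (M : Matrix k) r →
  ⟦ mapᴾ (mapᴾ shiftedSignᴾ) ⟧ (cons (encodeMatrix M) r) ≡ encodeMatrix (shiftedSignMatrix (length r) M)
⟦mapᴾ-shiftedSignᴾ⟧ M r =
  ⟦mapᴾ⟧-encodeVector (mapᴾ shiftedSignᴾ) r M λ i →
  ⟦mapᴾ⟧-encodeVector shiftedSignᴾ r (M i) λ j →
  ⟦shiftedSignᴾ⟧ (M i j) r

module _ {n k : ℕ} (P : FourBlock n k) where

  encodeLocal : Fin n → Tree
  encodeLocal t = cons (encodeMatrix (D P t)) (encodeVector encodeℤ (b P t))

  module _ (t : Fin n) where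

    l : Tree
    l = suffix encodeLocal (λ t → t) t

    spread : ∀ M → ⟦ mapᴾ (mapᴾ shiftedSignᴾ) ⟧ (cons (encodeMatrix M) l) ≡
                   encodeMatrix {k} (shiftedSignMatrix (n ∸ toℕ t) M)
    spread M = trans (⟦mapᴾ-shiftedSignᴾ⟧ M l)
      (cong (λ r → encodeMatrix (shiftedSignMatrix r M)) (length-suffix encodeLocal (λ t → t) t))

    ⟦sourceᴾ⟧ : ∀ s → ⟦ sourceᴾ s ⟧ (cons l (encode P)) ≡ encodeMatrix (sourceMatrix P t s)
    ⟦sourceᴾ⟧ A̲ = spread (A P)
    ⟦sourceᴾ⟧ B̲ = spread (B P)
    ⟦sourceᴾ⟧ C̲ = spread (C P)
    ⟦sourceᴾ⟧ D̲ = cong hd (hd-suffix encodeLocal (λ t → t) t)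

    ⟦localᴾ⟧ : ⟦ localᴾ ⟧ (cons l (encode P)) ≡
               cons (encodeMatrix (D (reduced P) t)) (encodeVector encodeℤ (b (reduced P) t))
    ⟦localᴾ⟧ = cong₂ cons
      (⟦layoutᴾ⟧ {w = A P} refl sourceᴾ (sourceMatrix P t) layoutD ⟦sourceᴾ⟧)
      (⟦paddedᴾ⟧ {w = A P} refl (tlᴾ ∘ᴾ hdᴾ ∘ᴾ hdᴾ) (b P t) (cong tl (hd-suffix encodeLocal (λ t → t) t)))
      where open Assemble (hdᴾ ∘ᴾ tlᴾ)

  abstract

    ⟦reducedᴾ⟧ : ⟦ reducedᴾ ⟧ (encode P) ≡ encode (reduced P)
    ⟦reducedᴾ⟧ =
      cong₂ cons (⟦layoutᴾ⟧ {w = A P} refl noSourceᴾ noSource layoutA (λ ())) (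
      cong₂ cons (⟦layoutᴾ⟧ {w = A P} refl noSourceᴾ noSource layoutB (λ ())) (
      cong₂ cons (⟦layoutᴾ⟧ {w = A P} refl noSourceᴾ noSource layoutC (λ ())) (
      cong₂ cons (⟦paddedᴾ⟧ {w = A P} refl (hdᴾ ∘ᴾ tlᴾ ∘ᴾ tlᴾ ∘ᴾ tlᴾ) (a P) refl)
        (trans (⟦mapSuffixesᴾ⟧ localᴾ (encodeVector encodeLocal (λ t → t)) (encode P))
               (mapSuffixes-encodeVector _ (λ t → t) ⟦localᴾ⟧)))))
      where open Assemble hdᴾ

-- Composing the reduction with a solver

infixr 5 _⨾ᴾ_

-- The input is wrapped into a stack with one entry and the result unwrapped. The code of `F`
-- preserves the other variables, so `p` starts with all of them nil.
_⨾ᴾ_ : PolyTime → Program → Program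
F ⨾ᴾ p = program (zero := consE stack nilE ⨾ code F ⨾ zero := hdE stack ⨾ body p)

⨾ᴾ-runs : ∀ F p {v w t} → p on ⟦ F ⟧ v outputs w inTime t →
          ∃[ t′ ] (F ⨾ᴾ p) on v outputs w inTime t′ × t′ ≤ 10 + time F v + t
⨾ᴾ-runs F p {v} {w} {t} (σ , p⇓) with runs F v nil (Vec.replicate (others p) nil)
... | s , F⇓ , s≤ = _ , (σ , seq assign (seq F⇓ (seq assign p⇓))) ,
  ≤-trans (≤-reflexive (steps s t)) (+-monoˡ-≤ t (+-monoʳ-≤ 10 s≤))
  where
  steps : ∀ s t → suc (4 + suc (s + suc (3 + t))) ≡ 10 + s + t
  steps = solve-∀

-- The new Δ in terms of the old parameters. In dimension 0 there are no entries, not even the 2 of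
-- the dummy.
reducedΔ : ℕ → ℕ → ℕ
reducedΔ zero    δ = 0
reducedΔ (suc k) δ = 2 ⊔ δ

Δ-reduced : ∀ {n} k (P : FourBlock n k) → Δ (reduced P) ≡ reducedΔ k (max‖D‖ P)
Δ-reduced zero    P = Δ-empty (reduced P)
Δ-reduced (suc k) P = Δ-reduced-suc P

-- Computability of the new parameters.

open Assemble nilᴾ using (aboveᴾ; ⟦aboveᴾ⟧)

fivefoldᴾ : PolyTime
fivefoldᴾ = aboveᴾ (hdᴾ ∷ hdᴾ ∷ hdᴾ ∷ hdᴾ ∷ hdᴾ ∷ [])

-- The input is cons k δ in unary.
parametersᴾ : PolyTime
parametersᴾ = ifᴾ hdᴾ then ⟨ fivefoldᴾ , ⟨ nilᴾ , ⟨ nilᴾ , tlᴾ ∘ᴾ tlᴾ ∘ᴾ tlᴾ ⟩ᴾ ⟩ᴾ ⟩ᴾ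
                      else ⟨ nilᴾ , nilᴾ ⟩ᴾ

-- A unary numeral is a vector of trivial entries, so stacking five copies as blocks multiplies by
-- 5.
encodeUnary-vector : ∀ m → encodeUnary m ≡ encodeVector {m = m} (λ (_ : ⊤) → nil) (λ _ → tt)
encodeUnary-vector zero    = refl
encodeUnary-vector (suc m) = cong (cons nil) (encodeUnary-vector m)

⟦fivefoldᴾ⟧ : ∀ k u → ⟦ fivefoldᴾ ⟧ (cons (encodeUnary k) u) ≡ encodeUnary (5 * k)
⟦fivefoldᴾ⟧ k u = trans
  (⟦aboveᴾ⟧ {⊤} {λ _ → nil} {5} {k} (hdᴾ ∷ hdᴾ ∷ hdᴾ ∷ hdᴾ ∷ hdᴾ ∷ []) (cons (encodeUnary k) u) (λ _ _ → tt)
    λ { 0F → eq ; 1F → eq ; 2F → eq ; 3F → eq ; 4F → eq })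
  (sym (encodeUnary-vector (5 * k)))
  where
  eq : encodeUnary k ≡ encodeVector {m = k} (λ (_ : ⊤) → nil) (λ _ → tt)
  eq = encodeUnary-vector k

⟦parametersᴾ⟧ : ∀ k δ → ⟦ parametersᴾ ⟧ (cons (encodeUnary k) (encodeUnary δ)) ≡
                        cons (encodeUnary (5 * k)) (encodeUnary (reducedΔ k δ))
⟦parametersᴾ⟧ zero    δ = refl
⟦parametersᴾ⟧ (suc k) δ = cong₂ cons
  (⟦fivefoldᴾ⟧ (suc k) (encodeUnary δ))
  (at-least-two δ)
  where
  -- Removing up to two units and then adding two gives the maximum with 2.
  at-least-two : ∀ δ → cons nil (cons nil (tl (tl (encodeUnary δ)))) ≡ encodeUnary (2 ⊔ δ)
  at-least-two zero          = refl
  at-least-two (suc zero)    = refl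
  at-least-two (suc (suc δ)) = refl

-- This excludes the value 0 for f wherever a solver meets its bound, so the additive cost of the
-- reduction can be multiplied by that value.
time-positive : ∀ {m} {c : Cmd m} {σ σ′ t} → ⟨ c , σ ⟩⇓[ t ] σ′ → 1 ≤ t
time-positive assign             = s≤s z≤n
time-positive (seq _ _)          = s≤s z≤n
time-positive (if-true _ _)      = s≤s z≤n
time-positive (if-false _ _)     = s≤s z≤n
time-positive (while-false _)    = s≤s z≤n
time-positive (while-true _ _ _) = s≤s z≤n

computable-reduced : ∀ {f} → Computable₂ f → Computable₂ (λ k δ → f (5 * k) (reducedΔ k δ))
computable-reduced {f} (p , p-computes) = parametersᴾ ⨾ᴾ p , λ k δ →
  let (t , p-runs) = p-computes (5 * k) (reducedΔ k δ)
      (t′ , runs′ , _) = ⨾ᴾ-runs parametersᴾ p (subst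
        (λ u → p on u outputs encodeUnary (f (5 * k) (reducedΔ k δ)) inTime t)
        (sym (⟦parametersᴾ⟧ k δ)) p-runs)
  in t′ , runs′

-- Running time of the composed program.

timeBound : ℕ → Tree → ℕ
timeBound c v = 10 + time reducedᴾ v + size (⟦ reducedᴾ ⟧ v) ^ c

abstract

  timeBound-poly : ∀ c → PolyBounded (timeBound c)
  timeBound-poly c = poly-+ (poly-+ (poly-const 10) (time-poly reducedᴾ)) (poly-^ (size-poly reducedᴾ) c)

2≤size-encode : ∀ {n k} (P : FourBlock n k) → 2 ≤ ‖ P ‖
2≤size-encode P = s≤s (≤-trans (s≤s z≤n) (m≤n+m _ (size (encodeMatrix (A P)))))

-- Replaces the base 2 + ‖P‖ of `PolyBounded` by ‖P‖ itself, at the price of doubling the exponent.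
[2+m]≤m² : ∀ {m} → 2 ≤ m → 2 + m ≤ m ^ 2
[2+m]≤m² {m} 2≤m = begin
  2 + m       ≤⟨ +-monoˡ-≤ m 2≤m ⟩
  m + m       ≡⟨ cong₂ _+_ refl (+-identityʳ m) ⟨
  2 * m       ≤⟨ *-monoˡ-≤ m 2≤m ⟩
  m * m       ≡⟨ cong (m *_) (*-identityʳ m) ⟨
  m ^ 2       ∎
  where open ≤-Reasoning

mainTheorem3 : (Σ[ f ∈ (ℕ → ℕ → ℕ) ] Computable₂ f
    × FeasibilitySolvable (λ _ → ⊤) (λ {n} {k} P → f k (Δ P))) →
    (Σ[ g ∈ (ℕ → ℕ → ℕ) ] Computable₂ g
    × FeasibilitySolvable ABCBoundedBy-n (λ {n} {k} P → g k (max‖D‖ P)))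
mainTheorem3 (f , f-computable , p , c , p-solves) =
  -- The bound g is f at the dimension and the Δ of the reduced program, both determined by the old
  -- parameters.
  (λ k δ → f (5 * k) (reducedΔ k δ)) , computable-reduced f-computable ,
  reducedᴾ ⨾ᴾ p , 2 * e , solves
  where
  e : ℕ
  e = proj₁ (timeBound-poly c)

  solves : ∀ {n k} (P : FourBlock n k) → ABCBoundedBy-n P →
    Σ[ answer ∈ Bool ] ∃[ t ]
      (reducedᴾ ⨾ᴾ p) on encode P outputs encodeBool answer inTime t
    × t ≤ f (5 * k) (reducedΔ k (max‖D‖ P)) * ‖ P ‖ ^ (2 * e)
    × (answer ≡ true ⇔ Feasible P)
  solves {n} {k} P bounded = answer , proj₁ run , proj₁ (proj₂ run) , time≤ ,
    ⇔-trans (proj₂ (proj₂ (proj₂ (proj₂ solution)))) (reduced-feasible P bounded)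
    where
    solution = p-solves (reduced P) tt
    answer : Bool
    answer = proj₁ solution
    t : ℕ
    t = proj₁ (proj₂ solution)
    p-runs : p on encode (reduced P) outputs encodeBool answer inTime t
    p-runs = proj₁ (proj₂ (proj₂ solution))
    t≤ : t ≤ f (5 * k) (Δ (reduced P)) * ‖ reduced P ‖ ^ c
    t≤ = proj₁ (proj₂ (proj₂ (proj₂ solution)))
    run : ∃[ t′ ] (reducedᴾ ⨾ᴾ p) on encode P outputs encodeBool answer inTime t′
                × t′ ≤ 10 + time reducedᴾ (encode P) + t
    run = ⨾ᴾ-runs reducedᴾ p (subst (λ u → p on u outputs encodeBool answer inTime t)
                                    (sym (⟦reducedᴾ⟧ P)) p-runs)
    open ≤-Reasoning
    F v′ w : ℕ
    F  = f (5 * k) (Δ (reduced P))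
    v′ = ‖ reduced P ‖ ^ c
    w  = 10 + time reducedᴾ (encode P)
    -- The solver takes at least one step, so its bound is not zero.
    F-positive : ∀ m → 1 ≤ m * v′ → 1 ≤ m
    F-positive (suc m) _ = s≤s z≤n
    time≤ : proj₁ run ≤ f (5 * k) (reducedΔ k (max‖D‖ P)) * ‖ P ‖ ^ (2 * e)
    time≤ = begin
      proj₁ run                       ≤⟨ proj₂ (proj₂ run) ⟩
      w + t                           ≤⟨ +-monoʳ-≤ w t≤ ⟩
      w + F * v′                      ≤⟨ +-monoˡ-≤ (F * v′) (m≤n*m w F {{>-nonZero (F-positive F (≤-trans (time-positive (proj₂ p-runs)) t≤))}}) ⟩
      F * w + F * v′                  ≡⟨ *-distribˡ-+ F w v′ ⟨
      F * (w + v′)                    ≡⟨ cong₂ (λ m u → m * (w + size u ^ c))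
                                           (cong (f (5 * k)) (Δ-reduced k P)) (sym (⟦reducedᴾ⟧ P)) ⟩
      G * timeBound c (encode P)      ≤⟨ *-monoʳ-≤ G (proj₂ (timeBound-poly c) (encode P)) ⟩
      G * (2 + ‖ P ‖) ^ e             ≤⟨ *-monoʳ-≤ G (^-monoˡ-≤ e ([2+m]≤m² (2≤size-encode P))) ⟩
      G * (‖ P ‖ ^ 2) ^ e             ≡⟨ cong (G *_) (^-*-assoc ‖ P ‖ 2 e) ⟩
      G * ‖ P ‖ ^ (2 * e)             ∎
      where
      G : ℕ
      G = f (5 * k) (reducedΔ k (max‖D‖ P))
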